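{- For any positive integers $v,h$ and any integer $a$, $$\#\mathbb{B}_{v,h,a}=\#\mathbb{Y}_{v,h,a}=\frac{1}{v+h}\sum_{d\mid(v+h,v)}\mu\!\left(\frac{d}{(d,a)}\right)\frac{\phi(d)}{\phi\!\left(\frac{d}{(d,a)}\right)}\binom{(v+h)/d}{v/d}.$$
   Context: $\mu$ is the Möbius function, $\phi$ is Euler's totient function, and $(d,a)$ is the greatest common divisor of $d$ and $a$; the sum is over positive divisors $d$ of $\gcd(v+h,v)$. $\mathbb{Y}_{v,h}$ is the set of bit sequences in $\{0,1\}^{v+h}$ with exactly $v$ zeros and $h$ ones; $\mathrm{inv}(\mathbf{x})=\#\{(i,j)\mid i<j,\ x_i>x_j\}$; $\mathbb{Y}_{v,h,a}:=\{\mathbf{x}\in\mathbb{Y}_{v,h}\mid\mathrm{inv}(\mathbf{x})\equiv a\pmod{v+h}\}$. $\mathbb{B}_{v,h,a}:=\{\sigma(\mathbf{x})\mid\mathbf{x}\in\mathbb{Y}_{v,h,a}\}$ where $\sigma(x_1x_2x_3\cdots x_{n-1}x_n):=x_1x_nx_2x_{n-1}x_3\cdots$. -}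

module Defs where

open import Data.Fin as Fin using (Fin)
open import Data.Fin.Patterns using (0F; 1F)
open import Data.Integer as ℤ using (ℤ; +_; 0ℤ; -1ℤ; ∣_∣)
import Data.Integer.Divisibility as ℤ
open import Data.List as List using (List; []; _∷_; length; filter; allFin; cartesianProduct; cartesianProductWith; upTo)
open import Data.List.Membership.Propositional using (_∈_; find; lose)
open import Data.List.Membership.Propositional.Properties using (∈-allFin; ∈-cartesianProductWith⁺; ∈-upTo⁺)
open import Data.List.Properties using (filter-some)
open import Data.List.Relation.Unary.Any using (here; any?)
open import Data.List.Relation.Unary.Unique.DecPropositional using (unique?)
open import Data.List.Relation.Unary.Unique.Propositional using (Unique; []; _∷_)
open import Data.List.Relation.Unary.Unique.Propositional.Properties using (allFin⁺; cartesianProductWith⁺)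
open import Data.List.Relation.Unary.All using ([])
open import Data.Nat as ℕ using (ℕ; zero; suc; NonZero; _+_)
open import Data.Nat.Combinatorics using (_C_)
open import Data.Nat.Coprimality using (coprime?; 1-coprimeTo)
open import Data.Nat.Divisibility using (_∣?_)
open import Data.Nat.DivMod using (_/_)
open import Data.Nat.GCD using (gcd; gcd[m,n]≢0; m/gcd[m,n]≢0)
open import Data.Nat.Primality.Factorisation using (factors; factorise)
open import Data.Product using (∃; _×_; _,_)
open import Data.Rational as ℚ using (ℚ; 0ℚ)
open import Data.Sum using (inj₁)
open import Data.Vec as Vec using (Vec; []; _∷_; lookup; count; reverse)
open import Data.Vec.Properties using (≡-dec; ∷-injective)
open import Function using (_∘_)
open import Relation.Binary.PropositionalEquality using (_≡_; refl)
open import Relation.Nullary using (yes; no)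
open import Relation.Nullary.Decidable using (map′; _×-dec_)
open import Relation.Unary using (Pred; Decidable)

Word : ℕ → Set
Word = Vec (Fin 2)

-- Every word of length n, exactly once.
words : ∀ n → List (Word n)
words zero    = [] ∷ []
words (suc n) = cartesianProductWith _∷_ (allFin 2) (words n)

words-complete : ∀ {n} (x : Word n) → x ∈ words n
words-complete []      = here refl
words-complete (b ∷ x) = ∈-cartesianProductWith⁺ _∷_ (∈-allFin b) (words-complete x)

words-unique : ∀ n → Unique (words n)
words-unique zero    = [] ∷ []
words-unique (suc n) = cartesianProductWith⁺ _∷_ ∷-injective (allFin⁺ 2) (words-unique n)

#_ : ∀ {n ℓ} {P : Pred (Word n) ℓ} → Decidable P → ℕ
# P? = length (filter P? (words _))

inv : ∀ {n} → Word n → ℕ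
inv {n} x = length (filter inversion? (cartesianProduct (allFin n) (allFin n)))
  where
  inversion? : Decidable (λ (i , j) → i Fin.< j × lookup x i Fin.> lookup x j)
  inversion? (i , j) = i Fin.<? j ×-dec lookup x j Fin.<? lookup x i

-- Taking the head and then reversing what is left alternates between the two
-- ends of the word: x₁ xₙ x₂ xₙ₋₁ x₃ ⋯
σ : ∀ {n} → Word n → Word n
σ {zero}  []       = []
σ {suc n} (b ∷ x) = b ∷ σ {n} (reverse x)

module _ (v h : ℕ) (a : ℤ) where

  Y : Pred (Word (v + h)) _
  Y x = count (Fin._≟ 0F) x ≡ v
      × count (Fin._≟ 1F) x ≡ h
      × + (v + h) ℤ.∣ + inv x ℤ.- a

  B : Pred (Word (v + h)) _
  B y = ∃ λ x → Y x × σ x ≡ y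

  Y? : Decidable Y
  Y? x = count (Fin._≟ 0F) x ℕ.≟ v
   ×-dec count (Fin._≟ 1F) x ℕ.≟ h
   ×-dec (v + h) ∣? ∣ + inv x ℤ.- a ∣

  B? : Decidable B
  B? y = map′ (λ p → let x , _ , q = find p in x , q)
              (λ (x , q) → lose (words-complete x) q)
              (any? (λ x → Y? x ×-dec ≡-dec Fin._≟_ (σ x) y) (words (v + h)))

-- A positive integer is squarefree exactly when its prime factors, listed with
-- multiplicity, are distinct.
μ : (n : ℕ) .{{_ : NonZero n}} → ℤ
μ n with unique? ℕ._≟_ (factors (factorise n))
... | yes _ = -1ℤ ℤ.^ length (factors (factorise n))
... | no  _ = 0ℤ

-- upTo n is 0, …, n - 1, so suc ranges over 1, …, n.
φ : ℕ → ℕ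
φ n = length (filter (λ k → coprime? (suc k) n) (upTo n))

divisorSum : (n : ℕ) → ((d : ℕ) .{{_ : NonZero d}} → ℚ) → ℚ
divisorSum n f = List.foldr ℚ._+_ 0ℚ (List.map (λ k → f (suc k)) (filter (λ k → suc k ∣? n) (upTo n)))

syntax divisorSum n (λ d → t) = Σ[ d ∣ n ] t

+-nonZero : ∀ m n .{{_ : NonZero m}} → NonZero (m + n)
+-nonZero (suc _) _ = _

φ-nonZero : ∀ n .{{_ : NonZero n}} → NonZero (φ n)
φ-nonZero n@(suc _) = ℕ.>-nonZero (filter-some (λ k → coprime? (suc k) n)
  (lose (∈-upTo⁺ (ℕ.s≤s ℕ.z≤n)) (1-coprimeTo n)))

module _ (d : ℕ) .{{_ : NonZero d}} (a : ℤ) where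

  gcd-nonZero : NonZero (gcd d ∣ a ∣)
  gcd-nonZero = ℕ.≢-nonZero (gcd[m,n]≢0 d ∣ a ∣ (inj₁ (ℕ.≢-nonZero⁻¹ d)))

  d/⟨d,a⟩ : ℕ
  d/⟨d,a⟩ = _/_ d (gcd d ∣ a ∣) {{gcd-nonZero}}

  d/⟨d,a⟩-nonZero : NonZero d/⟨d,a⟩
  d/⟨d,a⟩-nonZero = ℕ.≢-nonZero (m/gcd[m,n]≢0 d ∣ a ∣ {{gcd≢0 = gcd-nonZero}})

-- The division of v + h and of v by d is exact for every d that is summed over.
summand : (v h : ℕ) (a : ℤ) (d : ℕ) .{{_ : NonZero d}} → ℚ
summand v h a d =
        (μ e ℚ./ 1)
  ℚ.* (+ φ d ℚ./ φ e)
  ℚ.* (+ (((v + h) / d) C (v / d)) ℚ./ 1)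
  where
  e : ℕ
  e = d/⟨d,a⟩ d a
  instance
    e≢0 : NonZero e
    e≢0 = d/⟨d,a⟩-nonZero d a
    φe≢0 : NonZero (φ e)
    φe≢0 = φ-nonZero e

-- The count is a coefficient of a Gaussian binomial modulo X ^ (v + h) - 1, and roots of unity
-- would extract it.  Their role is played here by the Ramanujan sums c d : ℕ → ℚ, on which the
-- shift X acts like a primitive d-th root of unity.  Rotating a word of length d with h ones
-- changes inv by h modulo d, so for 0 < h < d the Gaussian binomial of length d, applied to c d,
-- is fixed by X ^ h and therefore vanishes.  Cutting words into blocks of length d then gives the
-- q-Lucas theorem: on c d, [v + h, v] acts as the binomial coefficient of (v + h) / d and v / d,
-- or as 0 when d ∤ v.  Summing over d ∣ v + h, where the c d a add up to v + h or 0 according as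
-- v + h divides a or not, yields the formula.

module Submission where

open import Defs

-- The sum of the a-th powers of the primitive d-th roots of unity is rational, so it can stand in
-- for the roots without an extension field. What is needed of a root is collected in `Primitive`:
-- over ℚ, its conditions say that the d-th cyclotomic polynomial in X annihilates the function.
-- They are linear, so every combination of shifts inherits them, in particular `gauss`. A function
-- that is also fixed by X ^ h with d ∤ h is fixed by X ^ (d / p) for some prime p dividing d; a
-- balanced sum then has p equal terms, and vanishes only if each of them does.
--
-- The price is that `c` is defined by Hölder's formula, which has the shape of the summand but
-- hides the roots. That `c d` is primitive, and that the sum over d ∣ v + h is as claimed, must
-- therefore come from comparing `c (p * d)` with `c d` for one prime p at a time, according to
-- whether p divides d and whether p divides the argument.
--
-- The equality of the two cardinalities is independent of all this: σ is injective, and a sum over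
-- all words does not change when σ is applied to its index.

module _ where

  open import Data.Bool using (true; false; if_then_else_)
  open import Data.Fin as Fin using (Fin)
  open import Data.Fin.Patterns using (0F; 1F)
  open import Data.Integer as ℤ using (ℤ; 0ℤ; 1ℤ; -1ℤ)
  import Data.Integer.DivMod as ℤ
  import Data.Integer.Divisibility.Signed as ℤ
  import Data.Integer.Properties as ℤ
  open import Data.List as List using (List; []; _∷_; length; filter; map; upTo; allFin; cartesianProduct)
  open import Data.List.Membership.Propositional using (_∈_)
  open import Data.List.Membership.Propositional.Properties using (∈-upTo⁻)
  open import Data.List.Properties using (upTo-∷ʳ; map-upTo; map-tabulate; length-upTo)
  open import Data.List.Relation.Binary.Permutation.Propositional using (_↭_; ↭⇒↭ₛ)
  open import Data.List.Relation.Binary.Permutation.Propositional.Properties using (↭-length)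
  import Data.List.Relation.Binary.Permutation.Setoid.Properties as ↭ₛ
  open import Data.List.Relation.Unary.All as All using (All; []; _∷_)
  open import Data.List.Relation.Unary.Any using (here; there)
  open import Data.List.Relation.Unary.Unique.DecPropositional using (unique?)
  open import Data.List.Relation.Unary.Unique.Propositional using (Unique; []; _∷_)
  open import Data.Nat as ℕ using (ℕ; zero; suc; NonZero; z≤n; s≤s)
  open import Data.Nat.Combinatorics using (_C_; k>n⇒nCk≡0; nCk+nC[k+1]≡[n+1]C[k+1])
  open import Data.Nat.Coprimality using (Coprime; coprime?; coprime-divisor; coprime-Bézout)
    renaming (sym to coprime-sym)
  open import Data.Nat.Divisibility
  import Data.Nat.DivMod as ℕ
  open import Data.Nat.DivMod using (_%_; m%n<n; m≡m%n+[m/n]*n; m*n/n≡m)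
  open import Data.Nat.GCD
  open import Data.Nat.Induction using (Acc; acc; <-wellFounded)
  open import Data.Nat.ListAction using (product)
  open import Data.Nat.ListAction.Properties using (∈⇒∣product)
  open import Data.Nat.Primality
    using (Prime; prime⇒nonZero; prime⇒nonTrivial; prime⇒irreducible; euclidsLemma; ¬prime[1]; productOfPrimes≢0)
  open import Data.Nat.Primality.Factorisation
    using (PrimeFactorisation; factorise; factors; factorisationUnique; factorisationHasAllPrimeFactors)
  import Data.Nat.Properties as ℕ
  import Data.Nat.Solver as ℕ
  open import Data.Product using (_×_; _,_; ∃; ∃₂)
  open import Data.Rational as ℚ using (ℚ; 0ℚ; 1ℚ; _+_; _*_; _-_; -_)
  import Data.Rational.Properties as ℚ
  import Data.Rational.Solver as ℚ
  import Data.Rational.Unnormalised as ℚᵘ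
  import Data.Rational.Unnormalised.Properties as ℚᵘ
  open import Data.Sum using (inj₁; inj₂)
  open import Data.Vec as Vec using ([]; _∷_; _++_; _∷ʳ_; lookup; count; reverse)
  open import Data.Vec.Properties using (reverse-∷; reverse-injective; ∷-injectiveˡ; ∷-injectiveʳ)
  open import Function using (_∘_; id; it)
  open import Relation.Binary using (tri<; tri≈; tri>)
  open import Relation.Binary.PropositionalEquality
    using (_≡_; _≢_; refl; sym; trans; cong; cong₂; subst; setoid; module ≡-Reasoning)
  open import Relation.Nullary using (Dec; yes; no; does; ¬_; contradiction)
  open import Relation.Nullary.Decidable using (_×-dec_; dec-true; dec-false)
  open import Relation.Unary using (Pred; Decidable)
  open ≡-Reasoning

  -- Sums over lists

  ∑ : ∀ {A : Set} → List A → (A → ℚ) → ℚ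
  ∑ xs f = List.foldr _+_ 0ℚ (map f xs)

  module _ {A : Set} where

    ∑-cong-∈ : ∀ (xs : List A) {f g : A → ℚ} → (∀ {x} → x ∈ xs → f x ≡ g x) → ∑ xs f ≡ ∑ xs g
    ∑-cong-∈ []       f≗g = refl
    ∑-cong-∈ (x ∷ xs) f≗g = cong₂ _+_ (f≗g (here refl)) (∑-cong-∈ xs (f≗g ∘ there))

    ∑-cong : ∀ (xs : List A) {f g : A → ℚ} → (∀ x → f x ≡ g x) → ∑ xs f ≡ ∑ xs g
    ∑-cong xs f≗g = ∑-cong-∈ xs (λ {x} _ → f≗g x)

    ∑-zero : ∀ (xs : List A) → ∑ xs (λ _ → 0ℚ) ≡ 0ℚ
    ∑-zero []       = refl
    ∑-zero (x ∷ xs) = trans (ℚ.+-identityˡ _) (∑-zero xs)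

    ∑-vanish : ∀ (xs : List A) {f : A → ℚ} → (∀ x → f x ≡ 0ℚ) → ∑ xs f ≡ 0ℚ
    ∑-vanish xs f≗0 = trans (∑-cong xs f≗0) (∑-zero xs)

    ∑-distrib-+ : ∀ (xs : List A) (f g : A → ℚ) → ∑ xs (λ x → f x + g x) ≡ ∑ xs f + ∑ xs g
    ∑-distrib-+ []       f g = refl
    ∑-distrib-+ (x ∷ xs) f g = trans (cong (f x + g x +_) (∑-distrib-+ xs f g))
      (solve 4 (λ a b c d → (a :+ b) :+ (c :+ d) := (a :+ c) :+ (b :+ d)) refl
        (f x) (g x) (∑ xs f) (∑ xs g))
      where open ℚ.+-*-Solver

    *-distribˡ-∑ : ∀ q (xs : List A) (f : A → ℚ) → q * ∑ xs f ≡ ∑ xs (λ x → q * f x)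
    *-distribˡ-∑ q []       f = ℚ.*-zeroʳ q
    *-distribˡ-∑ q (x ∷ xs) f =
      trans (ℚ.*-distribˡ-+ q (f x) (∑ xs f)) (cong (q * f x +_) (*-distribˡ-∑ q xs f))

    *-distribʳ-∑ : ∀ q (xs : List A) (f : A → ℚ) → ∑ xs f * q ≡ ∑ xs (λ x → f x * q)
    *-distribʳ-∑ q xs f = begin
      ∑ xs f * q           ≡⟨ ℚ.*-comm (∑ xs f) q ⟩
      q * ∑ xs f           ≡⟨ *-distribˡ-∑ q xs f ⟩
      ∑ xs (λ x → q * f x) ≡⟨ ∑-cong xs (λ x → ℚ.*-comm q (f x)) ⟩
      ∑ xs (λ x → f x * q) ∎

    ∑-++ : ∀ (xs ys : List A) (f : A → ℚ) → ∑ (xs List.++ ys) f ≡ ∑ xs f + ∑ ys f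
    ∑-++ []       ys f = sym (ℚ.+-identityˡ _)
    ∑-++ (x ∷ xs) ys f = trans (cong (f x +_) (∑-++ xs ys f)) (sym (ℚ.+-assoc (f x) _ _))

  ∑-comm : ∀ {A B : Set} (xs : List A) (ys : List B) (f : A → B → ℚ) →
           ∑ xs (λ x → ∑ ys (f x)) ≡ ∑ ys (λ y → ∑ xs (λ x → f x y))
  ∑-comm []       ys f = sym (∑-zero ys)
  ∑-comm (x ∷ xs) ys f = trans (cong (∑ ys (f x) +_) (∑-comm xs ys f))
                               (sym (∑-distrib-+ ys (f x) _))

  ∑-map : ∀ {A B : Set} (g : A → B) (xs : List A) (f : B → ℚ) → ∑ (map g xs) f ≡ ∑ xs (f ∘ g)
  ∑-map g []       f = refl
  ∑-map g (x ∷ xs) f = cong (f (g x) +_) (∑-map g xs f)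

  ∑-upTo-cong : ∀ n {f g : ℕ → ℚ} → (∀ {k} → k ℕ.< n → f k ≡ g k) → ∑ (upTo n) f ≡ ∑ (upTo n) g
  ∑-upTo-cong n f≗g = ∑-cong-∈ (upTo n) (f≗g ∘ ∈-upTo⁻)

  ∑-upTo-sucˡ : ∀ n (f : ℕ → ℚ) → ∑ (upTo (suc n)) f ≡ f 0 + ∑ (upTo n) (f ∘ suc)
  ∑-upTo-sucˡ n f = cong (f 0 +_) (trans (cong (λ ks → ∑ ks f) (sym (map-upTo suc n)))
                                         (∑-map suc (upTo n) f))

  ∑-upTo-+ : ∀ m n (f : ℕ → ℚ) → ∑ (upTo (m ℕ.+ n)) f ≡ ∑ (upTo m) f + ∑ (upTo n) (λ k → f (m ℕ.+ k))
  ∑-upTo-+ zero    n f = sym (ℚ.+-identityˡ _)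
  ∑-upTo-+ (suc m) n f = begin
    ∑ (upTo (suc m ℕ.+ n)) f
      ≡⟨ ∑-upTo-sucˡ (m ℕ.+ n) f ⟩
    f 0 + ∑ (upTo (m ℕ.+ n)) (f ∘ suc)
      ≡⟨ cong (f 0 +_) (∑-upTo-+ m n (f ∘ suc)) ⟩
    f 0 + (∑ (upTo m) (f ∘ suc) + ∑ (upTo n) (λ k → f (suc m ℕ.+ k)))
      ≡⟨ ℚ.+-assoc (f 0) _ _ ⟨
    f 0 + ∑ (upTo m) (f ∘ suc) + ∑ (upTo n) (λ k → f (suc m ℕ.+ k))
      ≡⟨ cong (_+ ∑ (upTo n) (λ k → f (suc m ℕ.+ k))) (∑-upTo-sucˡ m f) ⟨
    ∑ (upTo (suc m)) f + ∑ (upTo n) (λ k → f (suc m ℕ.+ k)) ∎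

  ∑-upTo-sucʳ : ∀ n (f : ℕ → ℚ) → ∑ (upTo (suc n)) f ≡ ∑ (upTo n) f + f n
  ∑-upTo-sucʳ n f = begin
    ∑ (upTo (suc n)) f                ≡⟨ cong (λ ks → ∑ ks f) (upTo-∷ʳ n) ⟨
    ∑ (upTo n List.∷ʳ n) f            ≡⟨ ∑-++ (upTo n) (n ∷ []) f ⟩
    ∑ (upTo n) f + (f n + 0ℚ)         ≡⟨ cong (∑ (upTo n) f +_) (ℚ.+-identityʳ (f n)) ⟩
    ∑ (upTo n) f + f n                ∎

  -- Division with remainder: each index below m * n is j * n + i for one j below m and one i below
  -- n.
  ∑-upTo-* : ∀ m n (f : ℕ → ℚ) →
             ∑ (upTo (m ℕ.* n)) f ≡ ∑ (upTo m) (λ j → ∑ (upTo n) (λ i → f (j ℕ.* n ℕ.+ i)))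
  ∑-upTo-* zero    n f = refl
  ∑-upTo-* (suc m) n f = begin
    ∑ (upTo (n ℕ.+ m ℕ.* n)) f
      ≡⟨ ∑-upTo-+ n (m ℕ.* n) f ⟩
    ∑ (upTo n) f + ∑ (upTo (m ℕ.* n)) (λ k → f (n ℕ.+ k))
      ≡⟨ cong (∑ (upTo n) f +_) (∑-upTo-* m n (λ k → f (n ℕ.+ k))) ⟩
    ∑ (upTo n) f + ∑ (upTo m) (λ j → ∑ (upTo n) (λ i → f (n ℕ.+ (j ℕ.* n ℕ.+ i))))
      ≡⟨ cong (∑ (upTo n) f +_) (∑-cong (upTo m) (λ j → ∑-cong (upTo n) (λ i →
           cong f (sym (ℕ.+-assoc n (j ℕ.* n) i))))) ⟩
    ∑ (upTo n) f + ∑ (upTo m) (λ j → ∑ (upTo n) (λ i → f (suc j ℕ.* n ℕ.+ i)))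
      ≡⟨ ∑-upTo-sucˡ m (λ j → ∑ (upTo n) (λ i → f (j ℕ.* n ℕ.+ i))) ⟨
    ∑ (upTo (suc m)) (λ j → ∑ (upTo n) (λ i → f (j ℕ.* n ℕ.+ i))) ∎

  ∑-upTo-extend : ∀ {m n} {f : ℕ → ℚ} → m ℕ.≤ n → (∀ {k} → m ℕ.≤ k → f k ≡ 0ℚ) →
                  ∑ (upTo n) f ≡ ∑ (upTo m) f
  ∑-upTo-extend {m} {n} {f} m≤n f≡0 = begin
    ∑ (upTo n) f
      ≡⟨ cong (λ k → ∑ (upTo k) f) (ℕ.m+[n∸m]≡n m≤n) ⟨
    ∑ (upTo (m ℕ.+ (n ℕ.∸ m))) f
      ≡⟨ ∑-upTo-+ m (n ℕ.∸ m) f ⟩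
    ∑ (upTo m) f + ∑ (upTo (n ℕ.∸ m)) (λ k → f (m ℕ.+ k))
      ≡⟨ cong (∑ (upTo m) f +_) (∑-vanish (upTo (n ℕ.∸ m)) (λ k → f≡0 (ℕ.m≤m+n m k))) ⟩
    ∑ (upTo m) f + 0ℚ
      ≡⟨ ℚ.+-identityʳ _ ⟩
    ∑ (upTo m) f ∎

  -- Indicators and embedded naturals

  𝟙 : ∀ {p} {P : Set p} → Dec P → ℚ
  𝟙 p? = if does p? then 1ℚ else 0ℚ

  𝟙-true : ∀ {p} {P : Set p} (p? : Dec P) → P → 𝟙 p? ≡ 1ℚ
  𝟙-true p? p = cong (if_then 1ℚ else 0ℚ) (dec-true p? p)

  𝟙-false : ∀ {p} {P : Set p} (p? : Dec P) → ¬ P → 𝟙 p? ≡ 0ℚ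
  𝟙-false p? ¬p = cong (if_then 1ℚ else 0ℚ) (dec-false p? ¬p)

  𝟙-⇔ : ∀ {p q} {P : Set p} {Q : Set q} (p? : Dec P) (q? : Dec Q) → (P → Q) → (Q → P) → 𝟙 p? ≡ 𝟙 q?
  𝟙-⇔ (yes p) q? P⇒Q Q⇒P = sym (𝟙-true q? (P⇒Q p))
  𝟙-⇔ (no ¬p) q? P⇒Q Q⇒P = sym (𝟙-false q? (¬p ∘ Q⇒P))

  𝟙-× : ∀ {p q} {P : Set p} {Q : Set q} (p? : Dec P) (q? : Dec Q) → 𝟙 (p? ×-dec q?) ≡ 𝟙 p? * 𝟙 q?
  𝟙-× (yes p) (yes q) = refl
  𝟙-× (yes p) (no ¬q) = refl
  𝟙-× (no ¬p) (yes q) = refl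
  𝟙-× (no ¬p) (no ¬q) = refl

  -- An equation need only hold where the indicator in front of it is 1.
  𝟙*-cong : ∀ {p} {P : Set p} (p? : Dec P) {x y : ℚ} → (P → x ≡ y) → 𝟙 p? * x ≡ 𝟙 p? * y
  𝟙*-cong (yes p) x≡y = cong (1ℚ *_) (x≡y p)
  𝟙*-cong (no ¬p) {x} {y} _ = trans (ℚ.*-zeroˡ x) (sym (ℚ.*-zeroˡ y))

  𝟙*-false : ∀ {p} {P : Set p} (p? : Dec P) → ¬ P → ∀ x → 𝟙 p? * x ≡ 0ℚ
  𝟙*-false p? ¬p x = trans (cong (_* x) (𝟙-false p? ¬p)) (ℚ.*-zeroˡ x)

  ∑-filter : ∀ {A : Set} {p} {P : Pred A p} (P? : Decidable P) (xs : List A) (f : A → ℚ) →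
             ∑ (filter P? xs) f ≡ ∑ xs (λ x → 𝟙 (P? x) * f x)
  ∑-filter P? []       f = refl
  ∑-filter P? (x ∷ xs) f with does (P? x)
  ... | true  = cong₂ _+_ (sym (ℚ.*-identityˡ (f x))) (∑-filter P? xs f)
  ... | false = trans (∑-filter P? xs f)
                      (sym (trans (cong (_+ ∑ xs (λ y → 𝟙 (P? y) * f y)) (ℚ.*-zeroˡ (f x))) (ℚ.+-identityˡ _)))

  -- Normalisation by gcds blocks direct computation with `_/_`; on unnormalised fractions the same
  -- equations are cross-multiplications of integers.
  toℚᵘ-/1 : ∀ i → ℚ.toℚᵘ (i ℚ./ 1) ℚᵘ.≃ ℚᵘ.mkℚᵘ i 0
  toℚᵘ-/1 i = ℚ.toℚᵘ-fromℚᵘ (ℚᵘ.mkℚᵘ i 0)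

  /1-homo-+ : ∀ i j → (i ℤ.+ j) ℚ./ 1 ≡ i ℚ./ 1 + j ℚ./ 1
  /1-homo-+ i j = ℚ.toℚᵘ-injective (ℚᵘ.≃-trans (toℚᵘ-/1 (i ℤ.+ j)) (ℚᵘ.≃-trans
    (ℚᵘ.*≡* (cong (ℤ._* ℤ.1ℤ) (cong₂ ℤ._+_ (sym (ℤ.*-identityʳ i)) (sym (ℤ.*-identityʳ j)))))
    (ℚᵘ.≃-sym (ℚᵘ.≃-trans (ℚ.toℚᵘ-homo-+ (i ℚ./ 1) (j ℚ./ 1)) (ℚᵘ.+-cong (toℚᵘ-/1 i) (toℚᵘ-/1 j))))))

  /1-homo-* : ∀ i j → (i ℤ.* j) ℚ./ 1 ≡ (i ℚ./ 1) * (j ℚ./ 1)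
  /1-homo-* i j = ℚ.toℚᵘ-injective (ℚᵘ.≃-trans (toℚᵘ-/1 (i ℤ.* j))
    (ℚᵘ.≃-sym (ℚᵘ.≃-trans (ℚ.toℚᵘ-homo-* (i ℚ./ 1) (j ℚ./ 1)) (ℚᵘ.*-cong (toℚᵘ-/1 i) (toℚᵘ-/1 j)))))

  fromℕ : ℕ → ℚ
  fromℕ n = ℤ.+ n ℚ./ 1

  fromℕ-+ : ∀ m n → fromℕ (m ℕ.+ n) ≡ fromℕ m + fromℕ n
  fromℕ-+ m n = /1-homo-+ (ℤ.+ m) (ℤ.+ n)

  fromℕ-* : ∀ m n → fromℕ (m ℕ.* n) ≡ fromℕ m * fromℕ n
  fromℕ-* m n = trans (cong (ℚ._/ 1) (ℤ.pos-* m n)) (/1-homo-* (ℤ.+ m) (ℤ.+ n))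

  fromℕ-injective : ∀ {m n} → fromℕ m ≡ fromℕ n → m ≡ n
  fromℕ-injective {m} {n} eq with ℚ./-injective-≃ (ℚᵘ.mkℚᵘ (ℤ.+ m) 0) (ℚᵘ.mkℚᵘ (ℤ.+ n) 0) eq
  ... | ℚᵘ.*≡* m*1≡n*1 = ℤ.+-injective (trans (sym (ℤ.*-identityʳ (ℤ.+ m))) (trans m*1≡n*1 (ℤ.*-identityʳ (ℤ.+ n))))

  /-as-* : ∀ i n .{{_ : NonZero n}} → i ℚ./ n ≡ i ℚ./ 1 * (ℤ.1ℤ ℚ./ n)
  /-as-* i n@(suc n-1) = ℚ.toℚᵘ-injective (ℚᵘ.≃-trans (ℚ.toℚᵘ-fromℚᵘ (ℚᵘ.mkℚᵘ i n-1)) (ℚᵘ.≃-trans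
    (ℚᵘ.*≡* (cong₂ ℤ._*_ (sym (ℤ.*-identityʳ i)) (cong (ℤ.+_ ∘ suc) (ℕ.+-identityʳ n-1))))
    (ℚᵘ.≃-sym (ℚᵘ.≃-trans (ℚ.toℚᵘ-homo-* (i ℚ./ 1) (ℤ.1ℤ ℚ./ n))
      (ℚᵘ.*-cong (toℚᵘ-/1 i) (ℚ.toℚᵘ-fromℚᵘ (ℚᵘ.mkℚᵘ ℤ.1ℤ n-1)))))))

  n/n≡1 : ∀ n .{{_ : NonZero n}} → ℤ.+ n ℚ./ n ≡ 1ℚ
  n/n≡1 n@(suc n-1) = ℚ.fromℚᵘ-cong {ℚᵘ.mkℚᵘ (ℤ.+ n) n-1} {ℚᵘ.mkℚᵘ (ℤ.+ 1) 0}
                        (ℚᵘ.*≡* (trans (ℤ.*-identityʳ (ℤ.+ n)) (sym (ℤ.*-identityˡ (ℤ.+ n)))))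

  n*1/n≡1 : ∀ n .{{_ : NonZero n}} → fromℕ n * (ℤ.+ 1 ℚ./ n) ≡ 1ℚ
  n*1/n≡1 n = trans (sym (/-as-* (ℤ.+ n) n)) (n/n≡1 n)

  n*x≡y⇒x≡1/n*y : ∀ n .{{_ : NonZero n}} {x y} → fromℕ n * x ≡ y → x ≡ (ℤ.+ 1 ℚ./ n) * y
  n*x≡y⇒x≡1/n*y n {x} {y} nx≡y = begin
    x                           ≡⟨ ℚ.*-identityˡ x ⟨
    1ℚ * x                      ≡⟨ cong (_* x) (n*1/n≡1 n) ⟨
    fromℕ n * 1/n * x           ≡⟨ solve 3 (λ a b c → a :* b :* c := b :* (a :* c)) refl (fromℕ n) 1/n x ⟩
    1/n * (fromℕ n * x)         ≡⟨ cong (1/n *_) nx≡y ⟩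
    1/n * y                     ∎
    where
    open ℚ.+-*-Solver
    1/n = ℤ.+ 1 ℚ./ n

  n*x≡0⇒x≡0 : ∀ n .{{_ : NonZero n}} {x} → fromℕ n * x ≡ 0ℚ → x ≡ 0ℚ
  n*x≡0⇒x≡0 n nx≡0 = trans (n*x≡y⇒x≡1/n*y n nx≡0) (ℚ.*-zeroʳ (ℤ.+ 1 ℚ./ n))

  ∑-const : ∀ {A : Set} (xs : List A) q → ∑ xs (λ _ → q) ≡ fromℕ (length xs) * q
  ∑-const []       q = sym (ℚ.*-zeroˡ q)
  ∑-const (x ∷ xs) q = begin
    q + ∑ xs (λ _ → q)             ≡⟨ cong (q +_) (∑-const xs q) ⟩
    q + fromℕ (length xs) * q      ≡⟨ solve 2 (λ n q → q :+ n :* q := (con 1ℚ :+ n) :* q) refl (fromℕ (length xs)) q ⟩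
    (1ℚ + fromℕ (length xs)) * q   ≡⟨ cong (_* q) (fromℕ-+ 1 (length xs)) ⟨
    fromℕ (suc (length xs)) * q    ∎
    where open ℚ.+-*-Solver

  ∑-upTo-const : ∀ n q → ∑ (upTo n) (λ _ → q) ≡ fromℕ n * q
  ∑-upTo-const n q = trans (∑-const (upTo n) q) (cong (λ k → fromℕ k * q) (length-upTo n))

  fromℕ-length-filter : ∀ {A : Set} {p} {P : Pred A p} (P? : Decidable P) (xs : List A) →
                        fromℕ (length (filter P? xs)) ≡ ∑ xs (λ x → 𝟙 (P? x))
  fromℕ-length-filter P? xs = begin
    fromℕ (length (filter P? xs))        ≡⟨ ℚ.*-identityʳ _ ⟨
    fromℕ (length (filter P? xs)) * 1ℚ   ≡⟨ ∑-const (filter P? xs) 1ℚ ⟨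
    ∑ (filter P? xs) (λ _ → 1ℚ)          ≡⟨ ∑-filter P? xs (λ _ → 1ℚ) ⟩
    ∑ xs (λ x → 𝟙 (P? x) * 1ℚ)           ≡⟨ ∑-cong xs (λ x → ℚ.*-identityʳ _) ⟩
    ∑ xs (λ x → 𝟙 (P? x))                ∎

  ∑-δ : ∀ n {i} → i ℕ.< n → ∑ (upTo n) (λ k → 𝟙 (k ℕ.≟ i)) ≡ 1ℚ
  ∑-δ (suc n) {i} i<1+n with ℕ.m≤n⇒m<n∨m≡n (ℕ.s≤s⁻¹ i<1+n)
  ... | inj₁ i<n = trans (∑-upTo-sucʳ n _)
    (cong₂ _+_ (∑-δ n i<n) (𝟙-false (n ℕ.≟ i) (λ n≡i → ℕ.<⇒≢ i<n (sym n≡i))))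
  ... | inj₂ i≡n = trans (∑-upTo-sucʳ n _)
    (cong₂ _+_ (trans (∑-upTo-cong n (λ {k} k<n → 𝟙-false (k ℕ.≟ i) (λ k≡i → ℕ.<⇒≢ k<n (trans k≡i i≡n)))) (∑-zero (upTo n)))
               (𝟙-true (n ℕ.≟ i) (sym i≡n)))

  -- Words and inversions

  ∑-words-suc : ∀ n (f : Word (suc n) → ℚ) →
                ∑ (words (suc n)) f ≡ ∑ (words n) (f ∘ (0F ∷_)) + ∑ (words n) (f ∘ (1F ∷_))
  ∑-words-suc n f = begin
    ∑ (map (0F ∷_) (words n) List.++ map (1F ∷_) (words n) List.++ []) f
      ≡⟨ ∑-++ (map (0F ∷_) (words n)) _ f ⟩
    ∑ (map (0F ∷_) (words n)) f + ∑ (map (1F ∷_) (words n) List.++ []) f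
      ≡⟨ cong₂ _+_ (∑-map (0F ∷_) (words n) f)
           (trans (∑-++ (map (1F ∷_) (words n)) [] f) (trans (ℚ.+-identityʳ _) (∑-map (1F ∷_) (words n) f))) ⟩
    ∑ (words n) (f ∘ (0F ∷_)) + ∑ (words n) (f ∘ (1F ∷_)) ∎

  -- Appending lists the words in another order than `words` does, so the equation holds for sums
  -- but not for the lists. Peeling off the first letter reduces it to the same claim for shorter
  -- words.
  ∑-words-∷ʳ : ∀ n (f : Word (suc n) → ℚ) →
               ∑ (words (suc n)) f ≡ ∑ (words n) (λ x → f (x ∷ʳ 0F)) + ∑ (words n) (λ x → f (x ∷ʳ 1F))
  ∑-words-∷ʳ zero    f = ∑-words-suc zero f
  ∑-words-∷ʳ (suc n) f = begin
    ∑ (words (suc (suc n))) f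
      ≡⟨ ∑-words-suc (suc n) f ⟩
    ∑ (words (suc n)) (f ∘ (0F ∷_)) + ∑ (words (suc n)) (f ∘ (1F ∷_))
      ≡⟨ cong₂ _+_ (∑-words-∷ʳ n (f ∘ (0F ∷_))) (∑-words-∷ʳ n (f ∘ (1F ∷_))) ⟩
    (s 0F 0F + s 0F 1F) + (s 1F 0F + s 1F 1F)
      ≡⟨ solve 4 (λ a b c d → (a :+ b) :+ (c :+ d) := (a :+ c) :+ (b :+ d)) refl
           (s 0F 0F) (s 0F 1F) (s 1F 0F) (s 1F 1F) ⟩
    (s 0F 0F + s 1F 0F) + (s 0F 1F + s 1F 1F)
      ≡⟨ cong₂ _+_ (∑-words-suc n (λ x → f (x ∷ʳ 0F))) (∑-words-suc n (λ x → f (x ∷ʳ 1F))) ⟨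
    ∑ (words (suc n)) (λ x → f (x ∷ʳ 0F)) + ∑ (words (suc n)) (λ x → f (x ∷ʳ 1F)) ∎
    where
    open ℚ.+-*-Solver
    s : Fin 2 → Fin 2 → ℚ
    s b c = ∑ (words n) (λ x → f ((b ∷ x) ∷ʳ c))

  ∑-words-++ : ∀ m n (f : Word (m ℕ.+ n) → ℚ) →
               ∑ (words (m ℕ.+ n)) f ≡ ∑ (words m) (λ x → ∑ (words n) (λ y → f (x ++ y)))
  ∑-words-++ zero    n f = sym (ℚ.+-identityʳ _)
  ∑-words-++ (suc m) n f = begin
    ∑ (words (suc m ℕ.+ n)) f
      ≡⟨ ∑-words-suc (m ℕ.+ n) f ⟩
    ∑ (words (m ℕ.+ n)) (f ∘ (0F ∷_)) + ∑ (words (m ℕ.+ n)) (f ∘ (1F ∷_))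
      ≡⟨ cong₂ _+_ (∑-words-++ m n (f ∘ (0F ∷_))) (∑-words-++ m n (f ∘ (1F ∷_))) ⟩
    ∑ (words m) (λ x → ∑ (words n) (λ y → f (0F ∷ x ++ y))) + ∑ (words m) (λ x → ∑ (words n) (λ y → f (1F ∷ x ++ y)))
      ≡⟨ ∑-words-suc m (λ x → ∑ (words n) (λ y → f (x ++ y))) ⟨
    ∑ (words (suc m)) (λ x → ∑ (words n) (λ y → f (x ++ y))) ∎

  ∑-words-reverse : ∀ n (f : Word n → ℚ) → ∑ (words n) (f ∘ reverse) ≡ ∑ (words n) f
  ∑-words-reverse zero    f = refl
  ∑-words-reverse (suc n) f = begin
    ∑ (words (suc n)) (f ∘ reverse)
      ≡⟨ ∑-words-suc n (f ∘ reverse) ⟩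
    ∑ (words n) (λ x → f (reverse (0F ∷ x))) + ∑ (words n) (λ x → f (reverse (1F ∷ x)))
      ≡⟨ cong₂ _+_ (step 0F) (step 1F) ⟩
    ∑ (words n) (λ x → f (x ∷ʳ 0F)) + ∑ (words n) (λ x → f (x ∷ʳ 1F))
      ≡⟨ ∑-words-∷ʳ n f ⟨
    ∑ (words (suc n)) f ∎
    where
    step : ∀ b → ∑ (words n) (λ x → f (reverse (b ∷ x))) ≡ ∑ (words n) (λ x → f (x ∷ʳ b))
    step b = trans (∑-cong (words n) (λ x → cong f (reverse-∷ b x))) (∑-words-reverse n (λ x → f (x ∷ʳ b)))

  -- σ keeps the first letter and applies `reverse` and then itself to the rest; both permute the
  -- shorter words.
  ∑-words-σ : ∀ n (f : Word n → ℚ) → ∑ (words n) (f ∘ σ) ≡ ∑ (words n) f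
  ∑-words-σ zero    f = refl
  ∑-words-σ (suc n) f = begin
    ∑ (words (suc n)) (f ∘ σ)
      ≡⟨ ∑-words-suc n (f ∘ σ) ⟩
    ∑ (words n) (λ x → f (0F ∷ σ (reverse x))) + ∑ (words n) (λ x → f (1F ∷ σ (reverse x)))
      ≡⟨ cong₂ _+_ (step 0F) (step 1F) ⟩
    ∑ (words n) (f ∘ (0F ∷_)) + ∑ (words n) (f ∘ (1F ∷_))
      ≡⟨ ∑-words-suc n f ⟨
    ∑ (words (suc n)) f ∎
    where
    step : ∀ b → ∑ (words n) (λ x → f (b ∷ σ (reverse x))) ≡ ∑ (words n) (λ x → f (b ∷ x))
    step b = trans (∑-words-reverse n (λ x → f (b ∷ σ x))) (∑-words-σ n (f ∘ (b ∷_)))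

  σ-injective : ∀ {n} (x y : Word n) → σ x ≡ σ y → x ≡ y
  σ-injective []      []      _  = refl
  σ-injective (b ∷ x) (c ∷ y) eq = cong₂ _∷_ (∷-injectiveˡ eq)
    (reverse-injective (σ-injective (reverse x) (reverse y) (∷-injectiveʳ eq)))

  -- After reindexing along σ the two indicators agree word by word, since injectivity makes
  -- `B (σ x)` equivalent to `Y x`.
  #B≡#Y : ∀ v h a → # B? v h a ≡ # Y? v h a
  #B≡#Y v h a = fromℕ-injective (begin
    fromℕ (# B? v h a)                                  ≡⟨ fromℕ-length-filter (B? v h a) (words (v ℕ.+ h)) ⟩
    ∑ (words (v ℕ.+ h)) (λ y → 𝟙 (B? v h a y))          ≡⟨ ∑-words-σ (v ℕ.+ h) (λ y → 𝟙 (B? v h a y)) ⟨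
    ∑ (words (v ℕ.+ h)) (λ x → 𝟙 (B? v h a (σ x)))
      ≡⟨ ∑-cong (words (v ℕ.+ h)) (λ x → 𝟙-⇔ (B? v h a (σ x)) (Y? v h a x)
                                                         (λ (x′ , Yx′ , σx′≡σx) → subst (Y v h a) (σ-injective x′ x σx′≡σx) Yx′)
                                                         (λ Yx → x , Yx , refl)) ⟩
    ∑ (words (v ℕ.+ h)) (λ x → 𝟙 (Y? v h a x))          ≡⟨ fromℕ-length-filter (Y? v h a) (words (v ℕ.+ h)) ⟨
    fromℕ (# Y? v h a)                                  ∎)

  -- Inversions under prepending, appending and concatenation

  zeros ones : ∀ {n} → Word n → ℕ
  zeros = count (Fin._≟ 0F)
  ones  = count (Fin._≟ 1F)

  ∑-allFin-suc : ∀ n (f : Fin (suc n) → ℚ) → ∑ (allFin (suc n)) f ≡ f 0F + ∑ (allFin n) (f ∘ Fin.suc)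
  ∑-allFin-suc n f = cong (f 0F +_) (trans (cong (λ is → ∑ is f) (sym (map-tabulate id Fin.suc)))
                                           (∑-map Fin.suc (allFin n) f))

  ∑-cartesianProduct : ∀ {A B : Set} (xs : List A) (ys : List B) (f : A × B → ℚ) →
                       ∑ (cartesianProduct xs ys) f ≡ ∑ xs (λ x → ∑ ys (λ y → f (x , y)))
  ∑-cartesianProduct []       ys f = refl
  ∑-cartesianProduct (x ∷ xs) ys f = trans (∑-++ (map (x ,_) ys) _ f)
    (cong₂ _+_ (∑-map (x ,_) ys f) (∑-cartesianProduct xs ys f))

  -- Being zero is written as being below `1F` because this is the condition for forming an
  -- inversion with a preceding one.
  fromℕ-zeros : ∀ {n} (x : Word n) → fromℕ (zeros x) ≡ ∑ (allFin n) (λ j → 𝟙 (Fin._<?_ {2} {2} (lookup x j) 1F))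
  fromℕ-zeros         []       = refl
  fromℕ-zeros {suc n} (0F ∷ x) = trans (fromℕ-+ 1 (zeros x))
    (trans (cong (1ℚ +_) (fromℕ-zeros x)) (sym (∑-allFin-suc n (λ j → 𝟙 (Fin._<?_ {2} {2} (lookup (0F ∷ x) j) 1F)))))
  fromℕ-zeros {suc n} (1F ∷ x) = trans (sym (ℚ.+-identityˡ _))
    (trans (cong (0ℚ +_) (fromℕ-zeros x)) (sym (∑-allFin-suc n (λ j → 𝟙 (Fin._<?_ {2} {2} (lookup (1F ∷ x) j) 1F)))))

  inv-term : ∀ {n} → Word n → Fin n → Fin n → ℚ
  inv-term x i j = 𝟙 (i Fin.<? j) * 𝟙 (lookup x j Fin.<? lookup x i)

  fromℕ-inv : ∀ {n} (x : Word n) → fromℕ (inv x) ≡ ∑ (allFin n) (λ i → ∑ (allFin n) (inv-term x i))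
  fromℕ-inv {n} x = begin
    fromℕ (inv x)
      ≡⟨ fromℕ-length-filter _ (cartesianProduct (allFin n) (allFin n)) ⟩
    ∑ (cartesianProduct (allFin n) (allFin n)) (λ (i , j) → 𝟙 (i Fin.<? j ×-dec lookup x j Fin.<? lookup x i))
      ≡⟨ ∑-cartesianProduct (allFin n) (allFin n) _ ⟩
    ∑ (allFin n) (λ i → ∑ (allFin n) (λ j → 𝟙 (i Fin.<? j ×-dec lookup x j Fin.<? lookup x i)))
      ≡⟨ ∑-cong (allFin n) (λ i → ∑-cong (allFin n) (λ j → 𝟙-× (i Fin.<? j) (lookup x j Fin.<? lookup x i))) ⟩
    ∑ (allFin n) (λ i → ∑ (allFin n) (inv-term x i)) ∎

  -- The row of pairs starting at the new letter is split off. In every other row the pair ending at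
  -- position 0 contributes nothing, its positions being in the wrong order.
  fromℕ-inv-∷ : ∀ {n} b (x : Word n) →
                fromℕ (inv (b ∷ x)) ≡ ∑ (allFin n) (λ j → 𝟙 (lookup x j Fin.<? b)) + fromℕ (inv x)
  fromℕ-inv-∷ {n} b x = begin
    fromℕ (inv (b ∷ x))
      ≡⟨ fromℕ-inv (b ∷ x) ⟩
    ∑ (allFin (suc n)) (λ i → ∑ (allFin (suc n)) (inv-term (b ∷ x) i))
      ≡⟨ ∑-allFin-suc n (λ i → ∑ (allFin (suc n)) (inv-term (b ∷ x) i)) ⟩
    ∑ (allFin (suc n)) (inv-term (b ∷ x) 0F) + ∑ (allFin n) (λ i → ∑ (allFin (suc n)) (inv-term (b ∷ x) (Fin.suc i)))
      ≡⟨ cong₂ _+_ head (trans (∑-cong (allFin n) tail) (sym (fromℕ-inv x))) ⟩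
    ∑ (allFin n) (λ j → 𝟙 (lookup x j Fin.<? b)) + fromℕ (inv x) ∎
    where
    head : ∑ (allFin (suc n)) (inv-term (b ∷ x) 0F) ≡ ∑ (allFin n) (λ j → 𝟙 (lookup x j Fin.<? b))
    head = begin
      ∑ (allFin (suc n)) (inv-term (b ∷ x) 0F)
        ≡⟨ ∑-allFin-suc n (inv-term (b ∷ x) 0F) ⟩
      0ℚ * 𝟙 (b Fin.<? b) + ∑ (allFin n) (λ j → 1ℚ * 𝟙 (lookup x j Fin.<? b))
        ≡⟨ cong₂ _+_ (ℚ.*-zeroˡ (𝟙 (b Fin.<? b))) (∑-cong (allFin n) (λ j → ℚ.*-identityˡ _)) ⟩
      0ℚ + ∑ (allFin n) (λ j → 𝟙 (lookup x j Fin.<? b))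
        ≡⟨ ℚ.+-identityˡ _ ⟩
      ∑ (allFin n) (λ j → 𝟙 (lookup x j Fin.<? b)) ∎

    tail : ∀ i → ∑ (allFin (suc n)) (inv-term (b ∷ x) (Fin.suc i)) ≡ ∑ (allFin n) (inv-term x i)
    tail i = begin
      ∑ (allFin (suc n)) (inv-term (b ∷ x) (Fin.suc i))
        ≡⟨ ∑-allFin-suc n (inv-term (b ∷ x) (Fin.suc i)) ⟩
      0ℚ * 𝟙 (b Fin.<? lookup x i) + ∑ (allFin n) (λ j → 𝟙 (Fin.suc i Fin.<? Fin.suc j) * 𝟙 (lookup x j Fin.<? lookup x i))
        ≡⟨ cong₂ _+_ (ℚ.*-zeroˡ (𝟙 (b Fin.<? lookup x i)))
             (∑-cong (allFin n) (λ j → cong (_* 𝟙 (lookup x j Fin.<? lookup x i))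
               (𝟙-⇔ (Fin.suc i Fin.<? Fin.suc j) (i Fin.<? j) ℕ.s<s⁻¹ ℕ.s<s))) ⟩
      0ℚ + ∑ (allFin n) (inv-term x i)
        ≡⟨ ℚ.+-identityˡ _ ⟩
      ∑ (allFin n) (inv-term x i) ∎

  inv-0∷ : ∀ {n} (x : Word n) → inv (0F ∷ x) ≡ inv x
  inv-0∷ {n} x = fromℕ-injective (trans (fromℕ-inv-∷ 0F x)
    (trans (cong (_+ fromℕ (inv x)) (∑-vanish (allFin n) (λ j → 𝟙-false (Fin._<?_ {2} {2} (lookup x j) 0F) λ ())))
           (ℚ.+-identityˡ _)))

  inv-1∷ : ∀ {n} (x : Word n) → inv (1F ∷ x) ≡ zeros x ℕ.+ inv x
  inv-1∷ x = fromℕ-injective (trans (fromℕ-inv-∷ 1F x)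
    (trans (cong (_+ fromℕ (inv x)) (sym (fromℕ-zeros x))) (sym (fromℕ-+ (zeros x) (inv x)))))

  zeros+ones : ∀ {n} (x : Word n) → zeros x ℕ.+ ones x ≡ n
  zeros+ones []       = refl
  zeros+ones (0F ∷ x) = cong suc (zeros+ones x)
  zeros+ones (1F ∷ x) = trans (ℕ.+-suc (zeros x) (ones x)) (cong suc (zeros+ones x))

  zeros-++ : ∀ {m n} (x : Word m) (y : Word n) → zeros (x ++ y) ≡ zeros x ℕ.+ zeros y
  zeros-++ []       y = refl
  zeros-++ (0F ∷ x) y = cong suc (zeros-++ x y)
  zeros-++ (1F ∷ x) y = zeros-++ x y

  zeros-∷ʳ : ∀ {n} (x : Word n) b → zeros (x ∷ʳ b) ≡ zeros (b ∷ x)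
  zeros-∷ʳ []       b  = refl
  zeros-∷ʳ (0F ∷ x) 0F = cong suc (zeros-∷ʳ x 0F)
  zeros-∷ʳ (0F ∷ x) 1F = cong suc (zeros-∷ʳ x 1F)
  zeros-∷ʳ (1F ∷ x) 0F = zeros-∷ʳ x 0F
  zeros-∷ʳ (1F ∷ x) 1F = zeros-∷ʳ x 1F

  inv-∷ʳ0 : ∀ {n} (x : Word n) → inv (x ∷ʳ 0F) ≡ inv x ℕ.+ ones x
  inv-∷ʳ0 []       = refl
  inv-∷ʳ0 (0F ∷ x) = trans (inv-0∷ (x ∷ʳ 0F)) (trans (inv-∷ʳ0 x) (cong (ℕ._+ ones x) (sym (inv-0∷ x))))
  inv-∷ʳ0 (1F ∷ x) = begin
    inv ((1F ∷ x) ∷ʳ 0F)                           ≡⟨ inv-1∷ (x ∷ʳ 0F) ⟩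
    zeros (x ∷ʳ 0F) ℕ.+ inv (x ∷ʳ 0F)              ≡⟨ cong₂ ℕ._+_ (zeros-∷ʳ x 0F) (inv-∷ʳ0 x) ⟩
    suc (zeros x) ℕ.+ (inv x ℕ.+ ones x)
      ≡⟨ solve 3 (λ z i o → con 1 :+ z :+ (i :+ o) := z :+ i :+ (con 1 :+ o)) refl (zeros x) (inv x) (ones x) ⟩
    zeros x ℕ.+ inv x ℕ.+ suc (ones x)             ≡⟨ cong (ℕ._+ suc (ones x)) (inv-1∷ x) ⟨
    inv (1F ∷ x) ℕ.+ suc (ones x)                  ∎
    where open ℕ.+-*-Solver

  inv-∷ʳ1 : ∀ {n} (x : Word n) → inv (x ∷ʳ 1F) ≡ inv x
  inv-∷ʳ1 []       = refl
  inv-∷ʳ1 (0F ∷ x) = trans (inv-0∷ (x ∷ʳ 1F)) (trans (inv-∷ʳ1 x) (sym (inv-0∷ x)))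
  inv-∷ʳ1 (1F ∷ x) = trans (inv-1∷ (x ∷ʳ 1F)) (trans (cong₂ ℕ._+_ (zeros-∷ʳ x 1F) (inv-∷ʳ1 x)) (sym (inv-1∷ x)))

  -- The product counts the inversions across the cut: every one of x stands before every zero of y.
  inv-++ : ∀ {m n} (x : Word m) (y : Word n) → inv (x ++ y) ≡ inv x ℕ.+ inv y ℕ.+ ones x ℕ.* zeros y
  inv-++ []       y = sym (ℕ.+-identityʳ (inv y))
  inv-++ (0F ∷ x) y = trans (inv-0∷ (x ++ y)) (trans (inv-++ x y)
    (cong (λ i → i ℕ.+ inv y ℕ.+ ones x ℕ.* zeros y) (sym (inv-0∷ x))))
  inv-++ (1F ∷ x) y = begin
    inv (1F ∷ x ++ y)
      ≡⟨ inv-1∷ (x ++ y) ⟩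
    zeros (x ++ y) ℕ.+ inv (x ++ y)
      ≡⟨ cong₂ ℕ._+_ (zeros-++ x y) (inv-++ x y) ⟩
    zeros x ℕ.+ zeros y ℕ.+ (inv x ℕ.+ inv y ℕ.+ ones x ℕ.* zeros y)
      ≡⟨ solve 5 (λ z z′ i i′ o → z :+ z′ :+ (i :+ i′ :+ o :* z′) := z :+ i :+ i′ :+ (con 1 :+ o) :* z′) refl
           (zeros x) (zeros y) (inv x) (inv y) (ones x) ⟩
    zeros x ℕ.+ inv x ℕ.+ inv y ℕ.+ suc (ones x) ℕ.* zeros y
      ≡⟨ cong (λ i → i ℕ.+ inv y ℕ.+ suc (ones x) ℕ.* zeros y) (inv-1∷ x) ⟨
    inv (1F ∷ x) ℕ.+ inv y ℕ.+ suc (ones x) ℕ.* zeros y ∎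
    where open ℕ.+-*-Solver

  -- Primitive functions and the q-Lucas theorem

  Stable : ℕ → (ℕ → ℚ) → Set
  Stable h f = ∀ a → f (a ℕ.+ h) ≡ f a

  -- Let (X f) a = f (a + 1).  On a primitive f, X acts like a primitive d-th root of unity:
  -- X ^ d = 1, and 1 + X ^ (d / p) + ⋯ + X ^ ((p - 1) d / p) = 0 for every prime p dividing d.
  record Primitive (d : ℕ) (f : ℕ → ℚ) : Set where
    field
      periodic : Stable d f
      balanced : ∀ p m → Prime p → p ℕ.* m ≡ d → ∀ a → ∑ (upTo p) (λ i → f (a ℕ.+ i ℕ.* m)) ≡ 0ℚ

  open Primitive

  stable-* : ∀ {h f} → Stable h f → ∀ k → Stable (k ℕ.* h) f
  stable-* {h} {f} st zero    a = cong f (ℕ.+-identityʳ a)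
  stable-* {h} {f} st (suc k) a = begin
    f (a ℕ.+ (h ℕ.+ k ℕ.* h))   ≡⟨ cong f (ℕ.+-assoc a h (k ℕ.* h)) ⟨
    f (a ℕ.+ h ℕ.+ k ℕ.* h)     ≡⟨ stable-* st k (a ℕ.+ h) ⟩
    f (a ℕ.+ h)                 ≡⟨ st a ⟩
    f a                         ∎

  -- Bézout without subtraction: adding a multiple of one period to the gcd yields a multiple of the
  -- other, and neither multiple changes f.
  stable-gcd : ∀ {m n f} → Stable m f → Stable n f → Stable (gcd m n) f
  stable-gcd {m} {n} {f} stm stn a with Bézout.identity (gcd-GCD m n)
  ... | Bézout.+- x y g+yn≡xm = begin
    f (a ℕ.+ gcd m n)                   ≡⟨ stable-* stn y (a ℕ.+ gcd m n) ⟨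
    f (a ℕ.+ gcd m n ℕ.+ y ℕ.* n)       ≡⟨ cong f (ℕ.+-assoc a (gcd m n) (y ℕ.* n)) ⟩
    f (a ℕ.+ (gcd m n ℕ.+ y ℕ.* n))     ≡⟨ cong (λ k → f (a ℕ.+ k)) g+yn≡xm ⟩
    f (a ℕ.+ x ℕ.* m)                   ≡⟨ stable-* stm x a ⟩
    f a                                 ∎
  ... | Bézout.-+ x y g+xm≡yn = begin
    f (a ℕ.+ gcd m n)                   ≡⟨ stable-* stm x (a ℕ.+ gcd m n) ⟨
    f (a ℕ.+ gcd m n ℕ.+ x ℕ.* m)       ≡⟨ cong f (ℕ.+-assoc a (gcd m n) (x ℕ.* m)) ⟩
    f (a ℕ.+ (gcd m n ℕ.+ x ℕ.* m))     ≡⟨ cong (λ k → f (a ℕ.+ k)) g+xm≡yn ⟩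
    f (a ℕ.+ y ℕ.* n)                   ≡⟨ stable-* stn y a ⟩
    f a                                 ∎

  ∃prime-factor : ∀ n .{{_ : NonZero n}} → n ≢ 1 → ∃₂ λ p m → Prime p × n ≡ p ℕ.* m
  ∃prime-factor n n≢1 with factorise n
  ... | record { factors = []     ; isFactorisation = n≡1 }                          = contradiction n≡1 n≢1
  ... | record { factors = p ∷ ps ; isFactorisation = n≡p*Πps ; factorsPrime = pr ∷ _ } = p , product ps , pr , n≡p*Πps

  -- As d ∤ h, the quotient of d by `gcd h d` is not 1 and has a prime factor p. Then d / p is a
  -- multiple of that gcd, hence a period of f, and the balanced sum in steps of d / p is p times
  -- `f a`.
  stable⇒≡0 : ∀ {d f h} .{{_ : NonZero d}} → Primitive d f → Stable h f → d ∤ h → ∀ a → f a ≡ 0ℚ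
  stable⇒≡0 {d} {f} {h} prim st d∤h a with gcd[m,n]∣n h d
  ... | divides q d≡q*g with ∃prime-factor q {{q≢0}} q≢1
    where
    g = gcd h d
    q≢0 : NonZero q
    q≢0 = ℕ.≢-nonZero λ q≡0 → ℕ.≢-nonZero⁻¹ d (trans d≡q*g (cong (ℕ._* g) q≡0))
    q≢1 : q ≢ 1
    q≢1 q≡1 = d∤h (subst (_∣ h) (sym (trans d≡q*g (trans (cong (ℕ._* g) q≡1) (ℕ.*-identityˡ g)))) (gcd[m,n]∣m h d))
  ... | p , r , pr , q≡p*r = n*x≡0⇒x≡0 p {{prime⇒nonZero pr}} (begin
    fromℕ p * f a                                 ≡⟨ ∑-upTo-const p (f a) ⟨
    ∑ (upTo p) (λ _ → f a)                        ≡⟨ ∑-cong (upTo p) (λ i → stable-* st-m i a) ⟨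
    ∑ (upTo p) (λ i → f (a ℕ.+ i ℕ.* m))          ≡⟨ balanced prim p m pr (sym d≡p*m) a ⟩
    0ℚ                                            ∎)
    where
    m = r ℕ.* gcd h d
    st-m : Stable m f
    st-m = stable-* (stable-gcd st (periodic prim)) r
    d≡p*m : d ≡ p ℕ.* m
    d≡p*m = trans d≡q*g (trans (cong (ℕ._* gcd h d) q≡p*r) (ℕ.*-assoc p r (gcd h d)))

  -- The Gaussian binomial coefficient [n, v] at q = X, applied to f.
  gauss : ∀ (n v : ℕ) → (ℕ → ℚ) → ℕ → ℚ
  gauss n v f a = ∑ (words n) (λ x → 𝟙 (zeros x ℕ.≟ v) * f (inv x ℕ.+ a))

  gauss-stable : ∀ n v {h f} → Stable h f → Stable h (gauss n v f)
  gauss-stable n v {h} {f} st a = ∑-cong (words n) (λ x → cong (𝟙 (zeros x ℕ.≟ v) *_)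
    (trans (cong f (sym (ℕ.+-assoc (inv x) a h))) (st (inv x ℕ.+ a))))

  -- `gauss n v f` is a linear combination of shifts of f, and both conditions are linear and
  -- commute with shifts.
  gauss-primitive : ∀ n v {d f} → Primitive d f → Primitive d (gauss n v f)
  gauss-primitive n v prim .periodic = gauss-stable n v (periodic prim)
  gauss-primitive n v {f = f} prim .balanced p m pr p*m≡d a = begin
    ∑ (upTo p) (λ i → ∑ (words n) (λ x → 𝟙 (zeros x ℕ.≟ v) * f (inv x ℕ.+ (a ℕ.+ i ℕ.* m))))
      ≡⟨ ∑-comm (upTo p) (words n) _ ⟩
    ∑ (words n) (λ x → ∑ (upTo p) (λ i → 𝟙 (zeros x ℕ.≟ v) * f (inv x ℕ.+ (a ℕ.+ i ℕ.* m))))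
      ≡⟨ ∑-vanish (words n) (λ x → begin
           ∑ (upTo p) (λ i → 𝟙 (zeros x ℕ.≟ v) * f (inv x ℕ.+ (a ℕ.+ i ℕ.* m)))
             ≡⟨ *-distribˡ-∑ (𝟙 (zeros x ℕ.≟ v)) (upTo p) _ ⟨
           𝟙 (zeros x ℕ.≟ v) * ∑ (upTo p) (λ i → f (inv x ℕ.+ (a ℕ.+ i ℕ.* m)))
             ≡⟨ cong (𝟙 (zeros x ℕ.≟ v) *_) (trans
                  (∑-cong (upTo p) (λ i → cong f (sym (ℕ.+-assoc (inv x) a (i ℕ.* m)))))
                  (balanced prim p m pr p*m≡d (inv x ℕ.+ a))) ⟩
           𝟙 (zeros x ℕ.≟ v) * 0ℚ
             ≡⟨ ℚ.*-zeroʳ (𝟙 (zeros x ℕ.≟ v)) ⟩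
           0ℚ ∎) ⟩
    0ℚ ∎

  -- Moving the first letter of a word with h ones to its end raises inv by h modulo the length.
  gauss-rotate : ∀ n v h {f} → v ℕ.+ h ≡ suc n → Stable (suc n) f → Stable h (gauss (suc n) v f)
  gauss-rotate n v h {f} v+h≡1+n st a = begin
    gauss (suc n) v f (a ℕ.+ h)
      ≡⟨ ∑-words-suc n (λ x → 𝟙 (zeros x ℕ.≟ v) * f (inv x ℕ.+ (a ℕ.+ h))) ⟩
    ∑ (words n) (λ x → 𝟙 (suc (zeros x) ℕ.≟ v) * f (inv (0F ∷ x) ℕ.+ (a ℕ.+ h)))
      + ∑ (words n) (λ x → 𝟙 (zeros x ℕ.≟ v) * f (inv (1F ∷ x) ℕ.+ (a ℕ.+ h)))
      ≡⟨ cong₂ _+_ (∑-cong (words n) step₀) (∑-cong (words n) step₁) ⟩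
    ∑ (words n) (λ x → 𝟙 (zeros (x ∷ʳ 0F) ℕ.≟ v) * f (inv (x ∷ʳ 0F) ℕ.+ a))
      + ∑ (words n) (λ x → 𝟙 (zeros (x ∷ʳ 1F) ℕ.≟ v) * f (inv (x ∷ʳ 1F) ℕ.+ a))
      ≡⟨ ∑-words-∷ʳ n (λ x → 𝟙 (zeros x ℕ.≟ v) * f (inv x ℕ.+ a)) ⟨
    gauss (suc n) v f a ∎
    where
    open ℕ.+-*-Solver

    step₀ : ∀ x → 𝟙 (suc (zeros x) ℕ.≟ v) * f (inv (0F ∷ x) ℕ.+ (a ℕ.+ h))
                  ≡ 𝟙 (zeros (x ∷ʳ 0F) ℕ.≟ v) * f (inv (x ∷ʳ 0F) ℕ.+ a)
    step₀ x rewrite zeros-∷ʳ x 0F = 𝟙*-cong (suc (zeros x) ℕ.≟ v) λ 1+z≡v → cong f (begin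
      inv (0F ∷ x) ℕ.+ (a ℕ.+ h)    ≡⟨ cong₂ (λ i o → i ℕ.+ (a ℕ.+ o)) (inv-0∷ x) (h≡ones 1+z≡v) ⟩
      inv x ℕ.+ (a ℕ.+ ones x)      ≡⟨ solve 3 (λ i a o → i :+ (a :+ o) := i :+ o :+ a) refl (inv x) a (ones x) ⟩
      inv x ℕ.+ ones x ℕ.+ a        ≡⟨ cong (ℕ._+ a) (inv-∷ʳ0 x) ⟨
      inv (x ∷ʳ 0F) ℕ.+ a           ∎)
      where
      h≡ones : suc (zeros x) ≡ v → h ≡ ones x
      h≡ones 1+z≡v = ℕ.+-cancelˡ-≡ (suc (zeros x)) h (ones x)
        (trans (cong (ℕ._+ h) 1+z≡v) (trans v+h≡1+n (cong suc (sym (zeros+ones x)))))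

    -- Moving a leading one to the end removes v inversions instead of adding h; the discrepancy v +
    -- h is the length, which is a period of f.
    step₁ : ∀ x → 𝟙 (zeros x ℕ.≟ v) * f (inv (1F ∷ x) ℕ.+ (a ℕ.+ h))
                  ≡ 𝟙 (zeros (x ∷ʳ 1F) ℕ.≟ v) * f (inv (x ∷ʳ 1F) ℕ.+ a)
    step₁ x rewrite zeros-∷ʳ x 1F = 𝟙*-cong (zeros x ℕ.≟ v) λ z≡v → begin
      f (inv (1F ∷ x) ℕ.+ (a ℕ.+ h))
        ≡⟨ cong (λ i → f (i ℕ.+ (a ℕ.+ h))) (trans (inv-1∷ x) (cong (ℕ._+ inv x) z≡v)) ⟩
      f (v ℕ.+ inv x ℕ.+ (a ℕ.+ h))
        ≡⟨ cong f (solve 4 (λ v i a h → v :+ i :+ (a :+ h) := i :+ a :+ (v :+ h)) refl v (inv x) a h) ⟩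
      f (inv x ℕ.+ a ℕ.+ (v ℕ.+ h))         ≡⟨ cong (λ k → f (inv x ℕ.+ a ℕ.+ k)) v+h≡1+n ⟩
      f (inv x ℕ.+ a ℕ.+ suc n)             ≡⟨ st (inv x ℕ.+ a) ⟩
      f (inv x ℕ.+ a)                       ≡⟨ cong (λ i → f (i ℕ.+ a)) (inv-∷ʳ1 x) ⟨
      f (inv (x ∷ʳ 1F) ℕ.+ a)               ∎

  gauss-middle : ∀ {d v f} → Primitive d f → 0 ℕ.< v → v ℕ.< d → ∀ a → gauss d v f a ≡ 0ℚ
  gauss-middle {suc n} {v} prim 0<v v<d = stable⇒≡0 (gauss-primitive (suc n) v prim)
    (gauss-rotate n v (suc n ℕ.∸ v) (ℕ.m+[n∸m]≡n (ℕ.<⇒≤ v<d)) (periodic prim))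
    (λ d∣d∸v → ℕ.<⇒≱ (ℕ.∸-monoʳ-< 0<v (ℕ.<⇒≤ v<d)) (∣⇒≤ {{ℕ.>-nonZero (ℕ.m<n⇒0<n∸m v<d)}} d∣d∸v))

  gauss-0 : ∀ n f a → gauss n 0 f a ≡ f a
  gauss-0 zero    f a = trans (ℚ.+-identityʳ _) (ℚ.*-identityˡ _)
  gauss-0 (suc n) f a = begin
    gauss (suc n) 0 f a
      ≡⟨ ∑-words-suc n (λ x → 𝟙 (zeros x ℕ.≟ 0) * f (inv x ℕ.+ a)) ⟩
    ∑ (words n) (λ x → 0ℚ * f (inv (0F ∷ x) ℕ.+ a)) + ∑ (words n) (λ x → 𝟙 (zeros x ℕ.≟ 0) * f (inv (1F ∷ x) ℕ.+ a))
      ≡⟨ cong₂ _+_ (∑-vanish (words n) (λ x → ℚ.*-zeroˡ (f (inv (0F ∷ x) ℕ.+ a))))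
           (∑-cong (words n) (λ x → 𝟙*-cong (zeros x ℕ.≟ 0) (λ z≡0 →
             cong (λ i → f (i ℕ.+ a)) (trans (inv-1∷ x) (cong (ℕ._+ inv x) z≡0))))) ⟩
    0ℚ + gauss n 0 f a
      ≡⟨ ℚ.+-identityˡ _ ⟩
    gauss n 0 f a
      ≡⟨ gauss-0 n f a ⟩
    f a ∎

  zeros≤length : ∀ {n} (x : Word n) → zeros x ℕ.≤ n
  zeros≤length x = subst (zeros x ℕ.≤_) (zeros+ones x) (ℕ.m≤m+n (zeros x) (ones x))

  gauss-> : ∀ {n v} → n ℕ.< v → ∀ f a → gauss n v f a ≡ 0ℚ
  gauss-> {n} {v} n<v f a = ∑-vanish (words n) (λ x →
    𝟙*-false (zeros x ℕ.≟ v) (ℕ.<⇒≢ (ℕ.≤-<-trans (zeros≤length x) n<v)) (f (inv x ℕ.+ a)))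

  gauss-n : ∀ n f a → gauss n n f a ≡ f a
  gauss-n zero    f a = gauss-0 zero f a
  gauss-n (suc n) f a = begin
    gauss (suc n) (suc n) f a
      ≡⟨ ∑-words-suc n (λ x → 𝟙 (zeros x ℕ.≟ suc n) * f (inv x ℕ.+ a)) ⟩
    ∑ (words n) (λ x → 𝟙 (suc (zeros x) ℕ.≟ suc n) * f (inv (0F ∷ x) ℕ.+ a))
      + ∑ (words n) (λ x → 𝟙 (zeros x ℕ.≟ suc n) * f (inv (1F ∷ x) ℕ.+ a))
      ≡⟨ cong₂ _+_
           (∑-cong (words n) (λ x → cong₂ (λ q i → q * f (i ℕ.+ a))
             (𝟙-⇔ (suc (zeros x) ℕ.≟ suc n) (zeros x ℕ.≟ n) ℕ.suc-injective (cong suc)) (inv-0∷ x)))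
           (∑-vanish (words n) (λ x →
             𝟙*-false (zeros x ℕ.≟ suc n) (ℕ.<⇒≢ (s≤s (zeros≤length x))) (f (inv (1F ∷ x) ℕ.+ a)))) ⟩
    gauss n n f a + 0ℚ
      ≡⟨ ℚ.+-identityʳ _ ⟩
    gauss n n f a
      ≡⟨ gauss-n n f a ⟩
    f a ∎

  module _ {d : ℕ} .{{_ : NonZero d}} {f : ℕ → ℚ} (prim : Primitive d f) where

    -- The contribution of the first d letters of a word whose remainder has t zeros.
    gauss-block : ∀ v t b → ∑ (words d) (λ x → 𝟙 (zeros x ℕ.+ t ℕ.≟ v) * f (inv x ℕ.+ (ones x ℕ.* t ℕ.+ b)))
                            ≡ (𝟙 (t ℕ.≟ v) + 𝟙 (d ℕ.+ t ℕ.≟ v)) * f b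
    gauss-block v t b with t ℕ.≤? v
    ... | no  t≰v = trans
      (∑-vanish (words d) (λ x →
        𝟙*-false (zeros x ℕ.+ t ℕ.≟ v) (λ eq → t≰v (subst (t ℕ.≤_) eq (ℕ.m≤n+m t (zeros x))))
          (f (inv x ℕ.+ (ones x ℕ.* t ℕ.+ b)))))
      (sym (trans (cong (_* f b) (cong₂ _+_
          (𝟙-false (t ℕ.≟ v) (λ eq → t≰v (ℕ.≤-reflexive eq)))
          (𝟙-false (d ℕ.+ t ℕ.≟ v) (λ eq → t≰v (subst (t ℕ.≤_) eq (ℕ.m≤n+m t d))))))
        (ℚ.*-zeroˡ (f b))))
    ... | yes t≤v = trans (∑-cong (words d) collect) (split (ℕ.<-cmp s d))
      where
      s = v ℕ.∸ t
      s+t≡v : s ℕ.+ t ≡ v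
      s+t≡v = ℕ.m∸n+n≡m t≤v

      -- Where the indicator is 1 the block has s zeros and `d ∸ s` ones, so the shift no longer
      -- depends on x and the sum becomes a single `gauss d s f`.
      collect : ∀ x → 𝟙 (zeros x ℕ.+ t ℕ.≟ v) * f (inv x ℕ.+ (ones x ℕ.* t ℕ.+ b))
                      ≡ 𝟙 (zeros x ℕ.≟ s) * f (inv x ℕ.+ ((d ℕ.∸ s) ℕ.* t ℕ.+ b))
      collect x = trans
        (cong (_* f (inv x ℕ.+ (ones x ℕ.* t ℕ.+ b))) (𝟙-⇔ (zeros x ℕ.+ t ℕ.≟ v) (zeros x ℕ.≟ s)
          (λ eq → ℕ.+-cancelʳ-≡ t (zeros x) s (trans eq (sym s+t≡v))) (λ eq → trans (cong (ℕ._+ t) eq) s+t≡v)))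
        (𝟙*-cong (zeros x ℕ.≟ s) (λ z≡s → cong (λ o → f (inv x ℕ.+ (o ℕ.* t ℕ.+ b)))
          (sym (trans (cong₂ ℕ._∸_ (sym (zeros+ones x)) (sym z≡s)) (ℕ.m+n∸m≡n (zeros x) (ones x))))))

      t≢v : 0 ℕ.< s → t ≢ v
      t≢v 0<s t≡v = ℕ.<⇒≢ 0<s (sym (trans (cong (ℕ._∸ t) (sym t≡v)) (ℕ.n∸n≡0 t)))

      d+t≢v : s ≢ d → d ℕ.+ t ≢ v
      d+t≢v s≢d eq = s≢d (trans (cong (ℕ._∸ t) (sym eq)) (ℕ.m+n∸n≡m d t))

      rhs : ∀ {p q} → 𝟙 (t ℕ.≟ v) ≡ p → 𝟙 (d ℕ.+ t ℕ.≟ v) ≡ q → (p + q) * f b ≡ (𝟙 (t ℕ.≟ v) + 𝟙 (d ℕ.+ t ℕ.≟ v)) * f b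
      rhs refl refl = refl

      split : _ → gauss d s f ((d ℕ.∸ s) ℕ.* t ℕ.+ b) ≡ (𝟙 (t ℕ.≟ v) + 𝟙 (d ℕ.+ t ℕ.≟ v)) * f b
      split (tri> _ s≢d d<s) = trans (gauss-> d<s f _) (trans (sym (ℚ.*-zeroˡ (f b)))
        (rhs (𝟙-false (t ℕ.≟ v) (t≢v (ℕ.≤-<-trans z≤n d<s))) (𝟙-false (d ℕ.+ t ℕ.≟ v) (d+t≢v s≢d))))
      split (tri≈ _ s≡d _) = begin
        gauss d s f ((d ℕ.∸ s) ℕ.* t ℕ.+ b)
          ≡⟨ cong₂ (λ i j → gauss d i f (j ℕ.* t ℕ.+ b)) s≡d (trans (cong (d ℕ.∸_) s≡d) (ℕ.n∸n≡0 d)) ⟩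
        gauss d d f b
          ≡⟨ gauss-n d f b ⟩
        f b
          ≡⟨ ℚ.*-identityˡ (f b) ⟨
        1ℚ * f b
          ≡⟨ rhs (𝟙-false (t ℕ.≟ v) (t≢v (subst (0 ℕ.<_) (sym s≡d) (ℕ.>-nonZero⁻¹ d))))
                 (𝟙-true (d ℕ.+ t ℕ.≟ v) (trans (cong (ℕ._+ t) (sym s≡d)) s+t≡v)) ⟩
        (𝟙 (t ℕ.≟ v) + 𝟙 (d ℕ.+ t ℕ.≟ v)) * f b ∎
      split (tri< s<d s≢d _) with s in s≡k
      ... | suc k = trans (gauss-middle prim (s≤s z≤n) s<d ((d ℕ.∸ suc k) ℕ.* t ℕ.+ b)) (trans (sym (ℚ.*-zeroˡ (f b)))
        (rhs (𝟙-false (t ℕ.≟ v) (t≢v (subst (0 ℕ.<_) (sym s≡k) (s≤s z≤n))))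
             (𝟙-false (d ℕ.+ t ℕ.≟ v) (d+t≢v (λ s≡d → s≢d (trans (sym s≡k) s≡d))))))
      ... | zero = begin
        gauss d 0 f (d ℕ.* t ℕ.+ b)
          ≡⟨ gauss-0 d f (d ℕ.* t ℕ.+ b) ⟩
        f (d ℕ.* t ℕ.+ b)
          ≡⟨ cong f (trans (ℕ.+-comm (d ℕ.* t) b) (cong (b ℕ.+_) (ℕ.*-comm d t))) ⟩
        f (b ℕ.+ t ℕ.* d)
          ≡⟨ stable-* (periodic prim) t b ⟩
        f b
          ≡⟨ ℚ.*-identityˡ (f b) ⟨
        1ℚ * f b
          ≡⟨ rhs (𝟙-true (t ℕ.≟ v) (trans (cong (ℕ._+ t) (sym s≡k)) s+t≡v))
                 (𝟙-false (d ℕ.+ t ℕ.≟ v) (d+t≢v (λ s≡d → s≢d (trans (sym s≡k) s≡d)))) ⟩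
        (𝟙 (t ℕ.≟ v) + 𝟙 (d ℕ.+ t ℕ.≟ v)) * f b ∎

    -- For a fixed remainder y, the inversions across the cut shift the argument by
    -- `ones x * zeros y`, which is the shift allowed for in `gauss-block`.
    gauss-+ : ∀ m v a → gauss (d ℕ.+ m) v f a
                        ≡ gauss m v f a + ∑ (words m) (λ y → 𝟙 (d ℕ.+ zeros y ℕ.≟ v) * f (inv y ℕ.+ a))
    gauss-+ m v a = begin
      gauss (d ℕ.+ m) v f a
        ≡⟨ ∑-words-++ d m _ ⟩
      ∑ (words d) (λ x → ∑ (words m) (λ y → 𝟙 (zeros (x ++ y) ℕ.≟ v) * f (inv (x ++ y) ℕ.+ a)))
        ≡⟨ ∑-comm (words d) (words m) _ ⟩
      ∑ (words m) (λ y → ∑ (words d) (λ x → 𝟙 (zeros (x ++ y) ℕ.≟ v) * f (inv (x ++ y) ℕ.+ a)))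
        ≡⟨ ∑-cong (words m) (λ y → trans (∑-cong (words d) (λ x → cong₂ (λ z i → 𝟙 (z ℕ.≟ v) * f i)
             (zeros-++ x y) (trans (cong (ℕ._+ a) (inv-++ x y)) (rearrange (inv x) (inv y) (ones x ℕ.* zeros y)))))
             (gauss-block v (zeros y) (inv y ℕ.+ a))) ⟩
      ∑ (words m) (λ y → (𝟙 (zeros y ℕ.≟ v) + 𝟙 (d ℕ.+ zeros y ℕ.≟ v)) * f (inv y ℕ.+ a))
        ≡⟨ ∑-cong (words m) (λ y → ℚ.*-distribʳ-+ (f (inv y ℕ.+ a)) (𝟙 (zeros y ℕ.≟ v)) (𝟙 (d ℕ.+ zeros y ℕ.≟ v))) ⟩
      ∑ (words m) (λ y → 𝟙 (zeros y ℕ.≟ v) * f (inv y ℕ.+ a) + 𝟙 (d ℕ.+ zeros y ℕ.≟ v) * f (inv y ℕ.+ a))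
        ≡⟨ ∑-distrib-+ (words m) _ _ ⟩
      gauss m v f a + ∑ (words m) (λ y → 𝟙 (d ℕ.+ zeros y ℕ.≟ v) * f (inv y ℕ.+ a)) ∎
      where
      rearrange : ∀ i j k → i ℕ.+ j ℕ.+ k ℕ.+ a ≡ i ℕ.+ (k ℕ.+ (j ℕ.+ a))
      rearrange i j k = solve 4 (λ i j k a → i :+ j :+ k :+ a := i :+ (k :+ (j :+ a))) refl i j k a
        where open ℕ.+-*-Solver

    gauss-+-< : ∀ m {v} a → v ℕ.< d → gauss (d ℕ.+ m) v f a ≡ gauss m v f a
    gauss-+-< m {v} a v<d = trans (gauss-+ m v a) (trans
      (cong (gauss m v f a +_) (∑-vanish (words m) (λ y →
        𝟙*-false (d ℕ.+ zeros y ℕ.≟ v) (λ eq → ℕ.<⇒≱ v<d (subst (d ℕ.≤_) eq (ℕ.m≤m+n d (zeros y))))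
          (f (inv y ℕ.+ a)))))
      (ℚ.+-identityʳ _))

    -- Pascal's rule in steps of d: effectively, a block of d letters is either all ones or all
    -- zeros.
    gauss-+-+ : ∀ m v a → gauss (d ℕ.+ m) (d ℕ.+ v) f a ≡ gauss m (d ℕ.+ v) f a + gauss m v f a
    gauss-+-+ m v a = trans (gauss-+ m (d ℕ.+ v) a) (cong (gauss m (d ℕ.+ v) f a +_)
      (∑-cong (words m) (λ y → cong (_* f (inv y ℕ.+ a))
        (𝟙-⇔ (d ℕ.+ zeros y ℕ.≟ d ℕ.+ v) (zeros y ℕ.≟ v) (ℕ.+-cancelˡ-≡ d (zeros y) v) (cong (d ℕ.+_))))))

    q-lucas : ∀ m k a → gauss (m ℕ.* d) (k ℕ.* d) f a ≡ fromℕ (m C k) * f a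
    q-lucas m zero a = trans (gauss-0 (m ℕ.* d) f a) (sym (ℚ.*-identityˡ (f a)))
    q-lucas zero (suc k) a = trans (gauss-> (ℕ.≤-trans (ℕ.>-nonZero⁻¹ d) (ℕ.m≤m+n d (k ℕ.* d))) f a)
      (trans (sym (ℚ.*-zeroˡ (f a))) (cong (λ j → fromℕ j * f a) (sym (k>n⇒nCk≡0 {0} {suc k} (s≤s z≤n)))))
    q-lucas (suc m) (suc k) a = begin
      gauss (d ℕ.+ m ℕ.* d) (d ℕ.+ k ℕ.* d) f a
        ≡⟨ gauss-+-+ (m ℕ.* d) (k ℕ.* d) a ⟩
      gauss (m ℕ.* d) (suc k ℕ.* d) f a + gauss (m ℕ.* d) (k ℕ.* d) f a
        ≡⟨ cong₂ _+_ (q-lucas m (suc k) a) (q-lucas m k a) ⟩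
      fromℕ (m C suc k) * f a + fromℕ (m C k) * f a
        ≡⟨ ℚ.*-distribʳ-+ (f a) (fromℕ (m C suc k)) (fromℕ (m C k)) ⟨
      (fromℕ (m C suc k) + fromℕ (m C k)) * f a
        ≡⟨ cong (_* f a) (trans (ℚ.+-comm (fromℕ (m C suc k)) (fromℕ (m C k))) (sym (fromℕ-+ (m C k) (m C suc k)))) ⟩
      fromℕ (m C k ℕ.+ m C suc k) * f a
        ≡⟨ cong (λ j → fromℕ j * f a) (nCk+nC[k+1]≡[n+1]C[k+1] m k) ⟩
      fromℕ (suc m C suc k) * f a ∎

    -- Removing a block leaves v unchanged or lowers it by d, so d ∤ v survives until the word is
    -- empty, and there v cannot be 0.
    q-lucas-∤ : ∀ m v a → d ∤ v → gauss (m ℕ.* d) v f a ≡ 0ℚ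
    q-lucas-∤ zero    zero    a d∤v = contradiction (d ∣0) d∤v
    q-lucas-∤ zero    (suc v) a d∤v = gauss-> {0} {suc v} (s≤s z≤n) f a
    q-lucas-∤ (suc m) v       a d∤v with d ℕ.≤? v
    ... | no  d≰v = trans (gauss-+-< (m ℕ.* d) a (ℕ.≰⇒> d≰v)) (q-lucas-∤ m v a d∤v)
    ... | yes d≤v with ℕ.m≤n⇒∃[o]m+o≡n d≤v
    ...   | w , refl = trans (gauss-+-+ (m ℕ.* d) w a)
      (cong₂ _+_ (q-lucas-∤ m (d ℕ.+ w) a d∤v) (q-lucas-∤ m w a (λ d∣w → d∤v (∣m∣n⇒∣m+n ∣-refl d∣w))))

  -- Euler's totient and the Möbius function

  coprime-*⁺ : ∀ {k m n} → Coprime k m → Coprime k n → Coprime k (m ℕ.* n)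
  coprime-*⁺ k⊥m k⊥n (c∣k , c∣mn) =
    k⊥n (c∣k , coprime-divisor (λ (b∣c , b∣m) → k⊥m (∣-trans b∣c c∣k , b∣m)) c∣mn)

  coprime-∣ʳ : ∀ {k m n} → m ∣ n → Coprime k n → Coprime k m
  coprime-∣ʳ m∣n k⊥n (c∣k , c∣m) = k⊥n (c∣k , ∣-trans c∣m m∣n)

  prime∤⇒coprime : ∀ {p n} → Prime p → p ∤ n → Coprime p n
  prime∤⇒coprime pr p∤n (c∣p , c∣n) with prime⇒irreducible pr c∣p
  ... | inj₁ c≡1  = c≡1
  ... | inj₂ refl = contradiction c∣n p∤n

  coprime-+* : ∀ j {d k} → Coprime (j ℕ.* d ℕ.+ k) d → Coprime k d
  coprime-+* j {d} {k} cop (c∣k , c∣d) = cop (∣m∣n⇒∣m+n (∣n⇒∣m*n j c∣d) c∣k , c∣d)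

  coprime-+*⁻ : ∀ j {d k} → Coprime k d → Coprime (j ℕ.* d ℕ.+ k) d
  coprime-+*⁻ j {d} {k} cop (c∣jd+k , c∣d) = cop (∣m+n∣m⇒∣n c∣jd+k (∣n⇒∣m*n j c∣d) , c∣d)

  fromℕ-φ : ∀ n → fromℕ (φ n) ≡ ∑ (upTo n) (λ k → 𝟙 (coprime? (suc k) n))
  fromℕ-φ n = fromℕ-length-filter (λ k → coprime? (suc k) n) (upTo n)

  -- Coprimality to d depends on the residue modulo d only, and the range consists of m full
  -- periods.
  ∑-coprime : ∀ m d → ∑ (upTo (m ℕ.* d)) (λ k → 𝟙 (coprime? (suc k) d)) ≡ fromℕ m * fromℕ (φ d)
  ∑-coprime m d = begin
    ∑ (upTo (m ℕ.* d)) (λ k → 𝟙 (coprime? (suc k) d))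
      ≡⟨ ∑-upTo-* m d _ ⟩
    ∑ (upTo m) (λ j → ∑ (upTo d) (λ i → 𝟙 (coprime? (suc (j ℕ.* d ℕ.+ i)) d)))
      ≡⟨ ∑-cong (upTo m) (λ j → trans (∑-cong (upTo d) (λ i →
           𝟙-⇔ (coprime? (suc (j ℕ.* d ℕ.+ i)) d) (coprime? (suc i) d)
             (λ cop → coprime-+* j (subst (λ k → Coprime k d) (sym (ℕ.+-suc (j ℕ.* d) i)) cop))
             (λ cop → subst (λ k → Coprime k d) (ℕ.+-suc (j ℕ.* d) i) (coprime-+*⁻ j cop))))
           (sym (fromℕ-φ d))) ⟩
    ∑ (upTo m) (λ _ → fromℕ (φ d))
      ≡⟨ ∑-upTo-const m (fromℕ (φ d)) ⟩
    fromℕ m * fromℕ (φ d) ∎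

  -- Because the summation index is one less than the number it stands for, the multiple of p in
  -- each block of p numbers is the last one.
  ∑-multiples : ∀ p .{{_ : NonZero p}} m (f : ℕ → ℚ) →
                ∑ (upTo (p ℕ.* m)) (λ k → 𝟙 (p ∣? suc k) * f (suc k)) ≡ ∑ (upTo m) (λ j → f (p ℕ.* suc j))
  ∑-multiples p@(suc p-1) m f = begin
    ∑ (upTo (p ℕ.* m)) g
      ≡⟨ cong (λ n → ∑ (upTo n) g) (ℕ.*-comm p m) ⟩
    ∑ (upTo (m ℕ.* p)) g
      ≡⟨ ∑-upTo-* m p g ⟩
    ∑ (upTo m) (λ j → ∑ (upTo p) (λ i → g (j ℕ.* p ℕ.+ i)))
      ≡⟨ ∑-cong (upTo m) (λ j → begin
           ∑ (upTo p) (λ i → g (j ℕ.* p ℕ.+ i))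
             ≡⟨ ∑-upTo-sucʳ p-1 _ ⟩
           ∑ (upTo p-1) (λ i → g (j ℕ.* p ℕ.+ i)) + g (j ℕ.* p ℕ.+ p-1)
             ≡⟨ cong₂ _+_ (trans (∑-upTo-cong p-1 (λ {i} → off j i)) (∑-zero (upTo p-1))) (on j) ⟩
           0ℚ + f (p ℕ.* suc j)
             ≡⟨ ℚ.+-identityˡ _ ⟩
           f (p ℕ.* suc j) ∎) ⟩
    ∑ (upTo m) (λ j → f (p ℕ.* suc j)) ∎
    where
    g : ℕ → ℚ
    g k = 𝟙 (p ∣? suc k) * f (suc k)

    off : ∀ j i → i ℕ.< p-1 → g (j ℕ.* p ℕ.+ i) ≡ 0ℚ
    off j i i<p-1 = 𝟙*-false (p ∣? suc (j ℕ.* p ℕ.+ i))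
      (λ p∣ → ℕ.<⇒≱ (s≤s i<p-1) (∣⇒≤ (∣m+n∣m⇒∣n (subst (p ∣_) (sym (ℕ.+-suc (j ℕ.* p) i)) p∣) (n∣m*n j))))
      (f (suc (j ℕ.* p ℕ.+ i)))

    last≡ : ∀ j → suc (j ℕ.* p ℕ.+ p-1) ≡ p ℕ.* suc j
    last≡ j = trans (sym (ℕ.+-suc (j ℕ.* p) p-1)) (trans (ℕ.+-comm (j ℕ.* p) p) (ℕ.*-comm (suc j) p))

    on : ∀ j → g (j ℕ.* p ℕ.+ p-1) ≡ f (p ℕ.* suc j)
    on j = trans
      (cong (_* f (suc (j ℕ.* p ℕ.+ p-1)))
        (𝟙-true (p ∣? suc (j ℕ.* p ℕ.+ p-1)) (subst (p ∣_) (sym (last≡ j)) (m∣m*n (suc j)))))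
      (trans (ℚ.*-identityˡ _) (cong f (last≡ j)))

  module _ {p : ℕ} (pr : Prime p) where

    private instance
      p≢0 : NonZero p
      p≢0 = prime⇒nonZero pr

    -- The factor p adds no new prime, so being coprime to p * d and to d are the same, counted over
    -- p periods.
    φ-ramified : ∀ {d} → p ∣ d → fromℕ (φ (p ℕ.* d)) ≡ fromℕ p * fromℕ (φ d)
    φ-ramified {d} p∣d = begin
      fromℕ (φ (p ℕ.* d))
        ≡⟨ fromℕ-φ (p ℕ.* d) ⟩
      ∑ (upTo (p ℕ.* d)) (λ k → 𝟙 (coprime? (suc k) (p ℕ.* d)))
        ≡⟨ ∑-cong (upTo (p ℕ.* d)) (λ k → 𝟙-⇔ (coprime? (suc k) (p ℕ.* d)) (coprime? (suc k) d)
             (coprime-∣ʳ (n∣m*n p)) (λ cop → coprime-*⁺ (coprime-∣ʳ p∣d cop) cop)) ⟩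
      ∑ (upTo (p ℕ.* d)) (λ k → 𝟙 (coprime? (suc k) d))
        ≡⟨ ∑-coprime p d ⟩
      fromℕ p * fromℕ (φ d) ∎

    -- Of the p φ(d) numbers up to p * d coprime to d, those not coprime to p * d are the p * s with
    -- s up to d coprime to d, and there are φ(d) of them.
    φ-unramified : ∀ {d} → p ∤ d → fromℕ (φ (p ℕ.* d)) ≡ (fromℕ p - 1ℚ) * fromℕ (φ d)
    φ-unramified {d} p∤d = begin
      fromℕ (φ (p ℕ.* d))
        ≡⟨ solve 2 (λ x y → x := (x :+ y) :- y) refl (fromℕ (φ (p ℕ.* d))) (fromℕ (φ d)) ⟩
      (fromℕ (φ (p ℕ.* d)) + fromℕ (φ d)) - fromℕ (φ d)
        ≡⟨ cong (_- fromℕ (φ d)) (sym total) ⟩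
      fromℕ p * fromℕ (φ d) - fromℕ (φ d)
        ≡⟨ solve 2 (λ x y → x :* y :- y := (x :- con 1ℚ) :* y) refl (fromℕ p) (fromℕ (φ d)) ⟩
      (fromℕ p - 1ℚ) * fromℕ (φ d) ∎
      where
      open ℚ.+-*-Solver

      coprime-p* : ∀ {s} → Coprime s d → Coprime (p ℕ.* s) d
      coprime-p* s⊥d = coprime-sym (coprime-*⁺ (coprime-sym (prime∤⇒coprime pr p∤d)) (coprime-sym s⊥d))

      split : ∀ s → 𝟙 (coprime? s d) ≡ 𝟙 (coprime? s (p ℕ.* d)) + 𝟙 (p ∣? s) * 𝟙 (coprime? s d)
      split s with p ∣? s
      ... | yes p∣s = sym (trans (cong (_+ 1ℚ * 𝟙 (coprime? s d)) (𝟙-false (coprime? s (p ℕ.* d))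
                        (λ cop → ¬prime[1] (subst Prime (cop (p∣s , m∣m*n d)) pr))))
                        (trans (ℚ.+-identityˡ _) (ℚ.*-identityˡ _)))
      ... | no  p∤s = trans (𝟙-⇔ (coprime? s d) (coprime? s (p ℕ.* d))
                        (λ cop → coprime-*⁺ (coprime-sym (prime∤⇒coprime pr p∤s)) cop) (coprime-∣ʳ (n∣m*n p)))
                        (sym (trans (cong (𝟙 (coprime? s (p ℕ.* d)) +_) (ℚ.*-zeroˡ (𝟙 (coprime? s d)))) (ℚ.+-identityʳ _)))

      total : fromℕ p * fromℕ (φ d) ≡ fromℕ (φ (p ℕ.* d)) + fromℕ (φ d)
      total = begin
        fromℕ p * fromℕ (φ d)
          ≡⟨ ∑-coprime p d ⟨
        ∑ (upTo (p ℕ.* d)) (λ k → 𝟙 (coprime? (suc k) d))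
          ≡⟨ ∑-cong (upTo (p ℕ.* d)) (λ k → split (suc k)) ⟩
        ∑ (upTo (p ℕ.* d)) (λ k → 𝟙 (coprime? (suc k) (p ℕ.* d)) + 𝟙 (p ∣? suc k) * 𝟙 (coprime? (suc k) d))
          ≡⟨ ∑-distrib-+ (upTo (p ℕ.* d)) _ _ ⟩
        ∑ (upTo (p ℕ.* d)) (λ k → 𝟙 (coprime? (suc k) (p ℕ.* d)))
          + ∑ (upTo (p ℕ.* d)) (λ k → 𝟙 (p ∣? suc k) * 𝟙 (coprime? (suc k) d))
          ≡⟨ cong₂ _+_ (sym (fromℕ-φ (p ℕ.* d))) (∑-multiples p d (λ s → 𝟙 (coprime? s d))) ⟩
        fromℕ (φ (p ℕ.* d)) + ∑ (upTo d) (λ j → 𝟙 (coprime? (p ℕ.* suc j) d))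
          ≡⟨ cong (fromℕ (φ (p ℕ.* d)) +_) (trans (∑-cong (upTo d) (λ j →
               𝟙-⇔ (coprime? (p ℕ.* suc j) d) (coprime? (suc j) d)
                 (λ cop → coprime-sym (coprime-∣ʳ (n∣m*n p) (coprime-sym cop))) coprime-p*))
               (sym (fromℕ-φ d))) ⟩
        fromℕ (φ (p ℕ.* d)) + fromℕ (φ d) ∎

  Unique-resp-↭ : ∀ {xs ys : List ℕ} → xs ↭ ys → Unique xs → Unique ys
  Unique-resp-↭ xs↭ys = ↭ₛ.Unique-resp-↭ (setoid ℕ) (↭⇒↭ₛ xs↭ys)

  -- Factorisations are unique up to permutation, so μ can be read off any of them, such as p
  -- prepended to one of m, rather than only the one that `factorise` computes.
  μ-unique : ∀ {n} .{{_ : NonZero n}} (f : PrimeFactorisation n) → Unique (factors f) → μ n ≡ -1ℤ ℤ.^ length (factors f)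
  μ-unique {n} f u with unique? ℕ._≟_ (factors (factorise n))
  ... | yes _ = cong (-1ℤ ℤ.^_) (↭-length (factorisationUnique (factorise n) f))
  ... | no ¬u = contradiction (Unique-resp-↭ (factorisationUnique f (factorise n)) u) ¬u

  μ-¬unique : ∀ {n} .{{_ : NonZero n}} (f : PrimeFactorisation n) → ¬ Unique (factors f) → μ n ≡ 0ℤ
  μ-¬unique {n} f ¬u with unique? ℕ._≟_ (factors (factorise n))
  ... | yes u = contradiction (Unique-resp-↭ (factorisationUnique (factorise n) f) u) ¬u
  ... | no _ = refl

  open PrimeFactorisation using (isFactorisation; factorsPrime)

  module _ {p m : ℕ} (pr : Prime p) .{{_ : NonZero m}} .{{_ : NonZero (p ℕ.* m)}} where

    private
      factorise-* : PrimeFactorisation (p ℕ.* m)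
      factorise-* = record
        { factors         = p ∷ factors (factorise m)
        ; isFactorisation = cong (p ℕ.*_) (isFactorisation (factorise m))
        ; factorsPrime    = pr ∷ factorsPrime (factorise m)
        }

      ∈⇒∣ : p ∈ factors (factorise m) → p ∣ m
      ∈⇒∣ p∈ = subst (p ∣_) (sym (isFactorisation (factorise m))) (∈⇒∣product p∈)

      ∣⇒∈ : p ∣ m → p ∈ factors (factorise m)
      ∣⇒∈ p∣m = factorisationHasAllPrimeFactors pr
        (subst (p ∣_) (isFactorisation (factorise m)) p∣m) (factorsPrime (factorise m))

    μ-ramified : p ∣ m → μ (p ℕ.* m) ≡ 0ℤ
    μ-ramified p∣m = μ-¬unique factorise-* λ { (p∉ ∷ _) → All.lookup p∉ (∣⇒∈ p∣m) refl }

    μ-unramified : p ∤ m → μ (p ℕ.* m) ≡ ℤ.- μ m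
    μ-unramified p∤m with unique? ℕ._≟_ (factors (factorise m))
    ... | yes u = trans
      (μ-unique factorise-* (All.tabulate (λ { q∈ refl → p∤m (∈⇒∣ q∈) }) ∷ u))
      (ℤ.-1*i≡-i _)
    ... | no ¬u = μ-¬unique factorise-* λ { (_ ∷ u) → ¬u u }

  -- Ramanujan sums

  -- The intended e is d / (d, a). It is a separate argument because multiplying d and a by p
  -- changes d while leaving e alone.
  hölder : (d e : ℕ) .{{_ : NonZero e}} → ℚ
  hölder d e = (μ e ℚ./ 1) * (ℚ._/_ (ℤ.+ φ d) (φ e) {{φ-nonZero e}})

  -- Hölder's formula for the Ramanujan sum; the value at d = 0 is junk.
  c : ℕ → ℕ → ℚ
  c zero      a = 0ℚ
  c d@(suc _) a = hölder d (d/⟨d,a⟩ d (ℤ.+ a)) {{d/⟨d,a⟩-nonZero d (ℤ.+ a)}}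

  hölder-cong : ∀ d {e e′} .{{_ : NonZero e}} .{{_ : NonZero e′}} → e ≡ e′ → hölder d e ≡ hölder d e′
  hölder-cong d refl = refl

  -- Identifying e by a product keeps natural-number division out of all later arguments.
  c≡hölder : ∀ d {e} a .{{_ : NonZero d}} .{{_ : NonZero e}} → e ℕ.* gcd d a ≡ d → c d a ≡ hölder d e
  c≡hölder d@(suc _) {e} a e*g≡d = hölder-cong d {{d/⟨d,a⟩-nonZero d (ℤ.+ a)}}
    (trans (ℕ./-congˡ {{gcd-nonZero d (ℤ.+ a)}} (sym e*g≡d)) (m*n/n≡m e (gcd d a) {{gcd-nonZero d (ℤ.+ a)}}))

  cofactor : ∀ d a .{{_ : NonZero d}} → ∃ λ e → NonZero e × e ℕ.* gcd d a ≡ d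
  cofactor d a with gcd[m,n]∣m d a
  ... | divides e d≡e*g = e , ℕ.≢-nonZero (λ e≡0 → ℕ.≢-nonZero⁻¹ d (trans d≡e*g (cong (ℕ._* gcd d a) e≡0))) , sym d≡e*g

  c-cong-gcd : ∀ d a b .{{_ : NonZero d}} → gcd d a ≡ gcd d b → c d a ≡ c d b
  c-cong-gcd d a b g≡ with cofactor d a
  ... | e , e≢0 , e*g≡d = trans (c≡hölder d a {{it}} {{e≢0}} e*g≡d)
                                (sym (c≡hölder d b {{it}} {{e≢0}} (trans (cong (e ℕ.*_) (sym g≡)) e*g≡d)))

  gcd-+* : ∀ d a k → gcd d (a ℕ.+ k ℕ.* d) ≡ gcd d a
  gcd-+* d a k = ∣-antisym
    (gcd-greatest (gcd[m,n]∣m d _)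
      (∣m+n∣m⇒∣n (subst (gcd d (a ℕ.+ k ℕ.* d) ∣_) (ℕ.+-comm a (k ℕ.* d)) (gcd[m,n]∣n d (a ℕ.+ k ℕ.* d)))
                 (∣n⇒∣m*n k (gcd[m,n]∣m d (a ℕ.+ k ℕ.* d)))))
    (gcd-greatest (gcd[m,n]∣m d a) (∣m∣n⇒∣m+n (gcd[m,n]∣n d a) (∣n⇒∣m*n k (gcd[m,n]∣m d a))))

  gcd-*-coprimeˡ : ∀ {p a} d → Coprime p a → gcd (p ℕ.* d) a ≡ gcd d a
  gcd-*-coprimeˡ {p} {a} d p⊥a = ∣-antisym
    (gcd-greatest
      (coprime-divisor (λ (b∣g , b∣p) → p⊥a (b∣p , ∣-trans b∣g (gcd[m,n]∣n (p ℕ.* d) a))) (gcd[m,n]∣m (p ℕ.* d) a))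
      (gcd[m,n]∣n (p ℕ.* d) a))
    (gcd-greatest (∣n⇒∣m*n p (gcd[m,n]∣m d a)) (gcd[m,n]∣n d a))

  private
    cancel-scale : ∀ {X D E D′ E′ r r′ : ℚ} → D′ ≡ X * D → E′ ≡ X * E → E * r ≡ 1ℚ → E′ * r′ ≡ 1ℚ → D′ * r′ ≡ D * r
    cancel-scale {X} {D} {E} {D′} {E′} {r} {r′} D′≡ E′≡ Er≡1 E′r′≡1 = begin
      D′ * r′                    ≡⟨ cong (_* r′) D′≡ ⟩
      X * D * r′                 ≡⟨ ℚ.*-identityʳ _ ⟨
      X * D * r′ * 1ℚ            ≡⟨ cong (X * D * r′ *_) Er≡1 ⟨
      X * D * r′ * (E * r)
        ≡⟨ solve 5 (λ X D r′ E r → X :* D :* r′ :* (E :* r) := D :* r :* (X :* E :* r′)) refl X D r′ E r ⟩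
      D * r * (X * E * r′)       ≡⟨ cong (λ y → D * r * (y * r′)) E′≡ ⟨
      D * r * (E′ * r′)          ≡⟨ cong (D * r *_) E′r′≡1 ⟩
      D * r * 1ℚ                 ≡⟨ ℚ.*-identityʳ _ ⟩
      D * r                      ∎
      where open ℚ.+-*-Solver

  hölder-scale : ∀ {q} d d′ e .{{_ : NonZero e}} → fromℕ (φ d′) ≡ q * fromℕ (φ d) → hölder d′ e ≡ q * hölder d e
  hölder-scale {q} d d′ e φd′≡qφd = begin
    (μ e ℚ./ 1) * (ℤ.+ φ d′ ℚ./ φ e)          ≡⟨ cong ((μ e ℚ./ 1) *_) (/-as-* (ℤ.+ φ d′) (φ e)) ⟩
    (μ e ℚ./ 1) * (fromℕ (φ d′) * r)          ≡⟨ cong (λ x → (μ e ℚ./ 1) * (x * r)) φd′≡qφd ⟩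
    (μ e ℚ./ 1) * (q * fromℕ (φ d) * r)
      ≡⟨ solve 4 (λ m q x r → m :* (q :* x :* r) := q :* (m :* (x :* r))) refl (μ e ℚ./ 1) q (fromℕ (φ d)) r ⟩
    q * ((μ e ℚ./ 1) * (fromℕ (φ d) * r))     ≡⟨ cong (λ x → q * ((μ e ℚ./ 1) * x)) (/-as-* (ℤ.+ φ d) (φ e)) ⟨
    q * hölder d e                            ∎
    where
    open ℚ.+-*-Solver
    instance
      φe≢0 : NonZero (φ e)
      φe≢0 = φ-nonZero e
    r : ℚ
    r = ℤ.1ℤ ℚ./ φ e

  module _ {p : ℕ} (pr : Prime p) (d : ℕ) .{{_ : NonZero d}} where

    private instance
      p≢0 : NonZero p
      p≢0 = prime⇒nonZero pr
      pd≢0 : NonZero (p ℕ.* d)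
      pd≢0 = ℕ.m*n≢0 p d

    private
      *-gcd : ∀ e a → e ℕ.* gcd d a ≡ d → e ℕ.* gcd (p ℕ.* d) (p ℕ.* a) ≡ p ℕ.* d
      *-gcd e a e*g≡d = begin
        e ℕ.* gcd (p ℕ.* d) (p ℕ.* a)   ≡⟨ cong (e ℕ.*_) (c*gcd[m,n]≡gcd[cm,cn] p d a) ⟨
        e ℕ.* (p ℕ.* gcd d a)           ≡⟨ solve 3 (λ e p g → e :* (p :* g) := p :* (e :* g)) refl e p (gcd d a) ⟩
        p ℕ.* (e ℕ.* gcd d a)           ≡⟨ cong (p ℕ.*_) e*g≡d ⟩
        p ℕ.* d                         ∎
        where open ℕ.+-*-Solver

      *-gcd-∤ : ∀ e a → p ∤ a → e ℕ.* gcd d a ≡ d → p ℕ.* e ℕ.* gcd (p ℕ.* d) a ≡ p ℕ.* d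
      *-gcd-∤ e a p∤a e*g≡d = begin
        p ℕ.* e ℕ.* gcd (p ℕ.* d) a     ≡⟨ cong (p ℕ.* e ℕ.*_) (gcd-*-coprimeˡ d (prime∤⇒coprime pr p∤a)) ⟩
        p ℕ.* e ℕ.* gcd d a             ≡⟨ ℕ.*-assoc p e (gcd d a) ⟩
        p ℕ.* (e ℕ.* gcd d a)           ≡⟨ cong (p ℕ.*_) e*g≡d ⟩
        p ℕ.* d                         ∎

    -- Scaling both arguments by p scales their gcd too, so the cofactor e is the same and only the
    -- totient in the numerator changes.
    c-*-scale : ∀ a {q} → fromℕ (φ (p ℕ.* d)) ≡ q * fromℕ (φ d) → c (p ℕ.* d) (p ℕ.* a) ≡ q * c d a
    c-*-scale a {q} φpd≡qφd = let e , e≢0 , e*g≡d = cofactor d a in begin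
      c (p ℕ.* d) (p ℕ.* a)   ≡⟨ c≡hölder (p ℕ.* d) (p ℕ.* a) {{it}} {{e≢0}} (*-gcd e a e*g≡d) ⟩
      hölder (p ℕ.* d) e {{e≢0}}      ≡⟨ hölder-scale {q} d (p ℕ.* d) e {{e≢0}} φpd≡qφd ⟩
      q * hölder d e {{e≢0}}  ≡⟨ cong (q *_) (c≡hölder d a {{it}} {{e≢0}} e*g≡d) ⟨
      q * c d a               ∎

    c-ramified-∣ : p ∣ d → ∀ a → c (p ℕ.* d) (p ℕ.* a) ≡ fromℕ p * c d a
    c-ramified-∣ p∣d a = c-*-scale a {fromℕ p} (φ-ramified pr p∣d)

    c-unramified-∣ : p ∤ d → ∀ a → c (p ℕ.* d) (p ℕ.* a) ≡ (fromℕ p - 1ℚ) * c d a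
    c-unramified-∣ p∤d a = c-*-scale a {fromℕ p - 1ℚ} (φ-unramified pr p∤d)

    c-coprime : p ∤ d → ∀ a → c d (p ℕ.* a) ≡ c d a
    c-coprime p∤d a = c-cong-gcd d (p ℕ.* a) a (trans (gcd-comm d (p ℕ.* a))
      (trans (gcd-*-coprimeˡ a (prime∤⇒coprime pr p∤d)) (gcd-comm a d)))

    -- Since p does not divide the gcd, all factors p of p * d, of which there are at least two, go
    -- into the cofactor, and μ vanishes there.
    c-ramified-∤ : p ∣ d → ∀ {a} → p ∤ a → c (p ℕ.* d) a ≡ 0ℚ
    c-ramified-∤ p∣d {a} p∤a = helper (cofactor d a)
      where
      helper : (∃ λ e → NonZero e × e ℕ.* gcd d a ≡ d) → c (p ℕ.* d) a ≡ 0ℚ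
      helper (e , e≢0 , e*g≡d) = begin
        c (p ℕ.* d) a                                        ≡⟨ c≡hölder (p ℕ.* d) {p ℕ.* e} a (*-gcd-∤ e a p∤a e*g≡d) ⟩
        (μ (p ℕ.* e) ℚ./ 1) * (ℤ.+ φ (p ℕ.* d) ℚ./ φ (p ℕ.* e))
          ≡⟨ cong (λ m → (m ℚ./ 1) * (ℤ.+ φ (p ℕ.* d) ℚ./ φ (p ℕ.* e))) (μ-ramified pr p∣e) ⟩
        0ℚ * (ℤ.+ φ (p ℕ.* d) ℚ./ φ (p ℕ.* e))                   ≡⟨ ℚ.*-zeroˡ (ℤ.+ φ (p ℕ.* d) ℚ./ φ (p ℕ.* e)) ⟩
        0ℚ                                                   ∎
        where
        instance
          e≢0′ : NonZero e
          e≢0′ = e≢0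
          pe≢0 : NonZero (p ℕ.* e)
          pe≢0 = ℕ.m*n≢0 p e
          φpe≢0 : NonZero (φ (p ℕ.* e))
          φpe≢0 = φ-nonZero (p ℕ.* e)
        p∣e : p ∣ e
        p∣e with euclidsLemma e (gcd d a) pr (subst (p ∣_) (sym e*g≡d) p∣d)
        ... | inj₁ p∣e = p∣e
        ... | inj₂ p∣g = contradiction (∣-trans p∣g (gcd[m,n]∣n d a)) p∤a

    -- The cofactor e gains a prime that it lacked: μ changes sign, while both totients gain a
    -- factor p - 1, which cancels.
    c-unramified-∤ : p ∤ d → ∀ {a} → p ∤ a → c (p ℕ.* d) a ≡ - c d a
    c-unramified-∤ p∤d {a} p∤a = helper (cofactor d a)
      where
      helper : (∃ λ e → NonZero e × e ℕ.* gcd d a ≡ d) → c (p ℕ.* d) a ≡ - c d a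
      helper (e , e≢0 , e*g≡d) = begin
        c (p ℕ.* d) a
          ≡⟨ c≡hölder (p ℕ.* d) {p ℕ.* e} a (*-gcd-∤ e a p∤a e*g≡d) ⟩
        (μ (p ℕ.* e) ℚ./ 1) * (ℤ.+ φ (p ℕ.* d) ℚ./ φ (p ℕ.* e))
          ≡⟨ cong₂ _*_ (trans (cong (ℚ._/ 1) (trans (μ-unramified pr p∤e) (sym (ℤ.-1*i≡-i (μ e))))) (/1-homo-* -1ℤ (μ e)))
                       (/-as-* (ℤ.+ φ (p ℕ.* d)) (φ (p ℕ.* e))) ⟩
        - 1ℚ * (μ e ℚ./ 1) * (fromℕ (φ (p ℕ.* d)) * (1ℤ ℚ./ φ (p ℕ.* e)))
          ≡⟨ cong (- 1ℚ * (μ e ℚ./ 1) *_) (cancel-scale {fromℕ p - 1ℚ} {fromℕ (φ d)} {fromℕ (φ e)}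
               (φ-unramified pr p∤d) (φ-unramified pr p∤e)
               (n*1/n≡1 (φ e)) (n*1/n≡1 (φ (p ℕ.* e)))) ⟩
        - 1ℚ * (μ e ℚ./ 1) * (fromℕ (φ d) * (1ℤ ℚ./ φ e))
          ≡⟨ solve 3 (λ m x r → (:- con 1ℚ) :* m :* (x :* r) := :- (m :* (x :* r))) refl (μ e ℚ./ 1) (fromℕ (φ d)) (1ℤ ℚ./ φ e) ⟩
        - ((μ e ℚ./ 1) * (fromℕ (φ d) * (1ℤ ℚ./ φ e)))
          ≡⟨ cong (λ x → - ((μ e ℚ./ 1) * x)) (/-as-* (ℤ.+ φ d) (φ e)) ⟨
        - hölder d e
          ≡⟨ cong -_ (c≡hölder d {e} a e*g≡d) ⟨
        - c d a ∎
        where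
        open ℚ.+-*-Solver
        instance
          e≢0′ : NonZero e
          e≢0′ = e≢0
          pe≢0 : NonZero (p ℕ.* e)
          pe≢0 = ℕ.m*n≢0 p e
          φe≢0 : NonZero (φ e)
          φe≢0 = φ-nonZero e
          φpe≢0 : NonZero (φ (p ℕ.* e))
          φpe≢0 = φ-nonZero (p ℕ.* e)
        p∤e : p ∤ e
        p∤e p∣e = p∤d (subst (p ∣_) e*g≡d (∣m⇒∣m*n (gcd d a) p∣e))

    -- Multiplicativity of Ramanujan sums: the first factor is the Ramanujan sum of modulus p,
    -- namely p - 1 or -1.
    c-unramified : p ∤ d → ∀ a → c (p ℕ.* d) a ≡ (fromℕ p * 𝟙 (p ∣? a) - 1ℚ) * c d a
    c-unramified p∤d a = helper a (p ∣? a)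
      where
      helper : ∀ a (p∣?a : Dec (p ∣ a)) → c (p ℕ.* d) a ≡ (fromℕ p * 𝟙 p∣?a - 1ℚ) * c d a
      helper a (yes (divides b refl)) = begin
        c (p ℕ.* d) (b ℕ.* p)                   ≡⟨ cong (c (p ℕ.* d)) (ℕ.*-comm b p) ⟩
        c (p ℕ.* d) (p ℕ.* b)                   ≡⟨ c-unramified-∣ p∤d b ⟩
        (fromℕ p - 1ℚ) * c d b                  ≡⟨ cong₂ (λ x y → (x - 1ℚ) * y) (sym (ℚ.*-identityʳ (fromℕ p)))
                                                     (trans (sym (c-coprime p∤d b)) (cong (c d) (ℕ.*-comm p b))) ⟩
        (fromℕ p * 1ℚ - 1ℚ) * c d (b ℕ.* p)     ∎
      helper a (no p∤a) = trans (c-unramified-∤ p∤d p∤a)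
        (solve 2 (λ p x → :- x := (p :* con 0ℚ :- con 1ℚ) :* x) refl (fromℕ p) (c d a))
        where open ℚ.+-*-Solver

  -- Ramanujan sums along arithmetic progressions and over divisors

  coprime-residue : ∀ {p m} .{{_ : NonZero p}} → Coprime p m → ∀ a → ∃ λ i → i ℕ.< p × p ∣ a ℕ.+ i ℕ.* m
  coprime-residue {p} {m} p⊥m a = reduce (solution (coprime-Bézout p⊥m))
    where
    open ℕ.+-*-Solver

    solution : Bézout.Identity 1 p m → ∃ λ j → p ∣ a ℕ.+ j ℕ.* m
    solution (Bézout.+- x y 1+ym≡xp) = a ℕ.* y , divides (a ℕ.* x) (begin
      a ℕ.+ a ℕ.* y ℕ.* m       ≡⟨ solve 3 (λ a y m → a :+ a :* y :* m := a :* (con 1 :+ y :* m)) refl a y m ⟩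
      a ℕ.* (1 ℕ.+ y ℕ.* m)     ≡⟨ cong (a ℕ.*_) 1+ym≡xp ⟩
      a ℕ.* (x ℕ.* p)           ≡⟨ ℕ.*-assoc a x p ⟨
      a ℕ.* x ℕ.* p             ∎)
    -- Here y inverts m modulo p, so -a * y is wanted; `pred p` serves as -1.
    solution (Bézout.-+ x y 1+xp≡ym) = a ℕ.* ℕ.pred p ℕ.* y , divides (a ℕ.* (1 ℕ.+ ℕ.pred p ℕ.* x)) (begin
      a ℕ.+ a ℕ.* ℕ.pred p ℕ.* y ℕ.* m
        ≡⟨ solve 4 (λ a q y m → a :+ a :* q :* y :* m := a :+ a :* q :* (y :* m)) refl a (ℕ.pred p) y m ⟩
      a ℕ.+ a ℕ.* ℕ.pred p ℕ.* (y ℕ.* m)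
        ≡⟨ cong (λ k → a ℕ.+ a ℕ.* ℕ.pred p ℕ.* k) 1+xp≡ym ⟨
      a ℕ.+ a ℕ.* ℕ.pred p ℕ.* (1 ℕ.+ x ℕ.* p)
        ≡⟨ solve 4 (λ a q x p → a :+ a :* q :* (con 1 :+ x :* p) := a :* (con 1 :+ q) :+ a :* q :* x :* p) refl a (ℕ.pred p) x p ⟩
      a ℕ.* (1 ℕ.+ ℕ.pred p) ℕ.+ a ℕ.* ℕ.pred p ℕ.* x ℕ.* p
        ≡⟨ cong (λ k → a ℕ.* k ℕ.+ a ℕ.* ℕ.pred p ℕ.* x ℕ.* p) (ℕ.suc-pred p) ⟩
      a ℕ.* p ℕ.+ a ℕ.* ℕ.pred p ℕ.* x ℕ.* p
        ≡⟨ solve 4 (λ a q x p → a :* p :+ a :* q :* x :* p := a :* (con 1 :+ q :* x) :* p) refl a (ℕ.pred p) x p ⟩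
      a ℕ.* (1 ℕ.+ ℕ.pred p ℕ.* x) ℕ.* p ∎)

    reduce : (∃ λ j → p ∣ a ℕ.+ j ℕ.* m) → ∃ λ i → i ℕ.< p × p ∣ a ℕ.+ i ℕ.* m
    reduce (j , p∣a+jm) = j % p , m%n<n j p , ∣m+n∣m⇒∣n (subst (p ∣_) (begin
      a ℕ.+ j ℕ.* m                                       ≡⟨ cong (λ k → a ℕ.+ k ℕ.* m) (m≡m%n+[m/n]*n j p) ⟩
      a ℕ.+ (j % p ℕ.+ (j ℕ./ p) ℕ.* p) ℕ.* m
        ≡⟨ solve 5 (λ a r q p m → a :+ (r :+ q :* p) :* m := q :* m :* p :+ (a :+ r :* m)) refl a (j % p) (j ℕ./ p) p m ⟩
      (j ℕ./ p) ℕ.* m ℕ.* p ℕ.+ (a ℕ.+ j % p ℕ.* m)       ∎) p∣a+jm) (n∣m*n ((j ℕ./ p) ℕ.* m))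

  -- The difference of the two multiples is m * (j ∸ i), so p divides `j ∸ i`, which is below p.
  coprime-residue-≤ : ∀ {p m} → Coprime p m → ∀ a {i j} → i ℕ.≤ j → j ℕ.< p →
                      p ∣ a ℕ.+ i ℕ.* m → p ∣ a ℕ.+ j ℕ.* m → i ≡ j
  coprime-residue-≤ {p} {m} p⊥m a {i} {j} i≤j j<p p∣i p∣j = helper (j ℕ.∸ i) refl
    where
    j≡i+[j∸i] : i ℕ.+ (j ℕ.∸ i) ≡ j
    j≡i+[j∸i] = ℕ.m+[n∸m]≡n i≤j
    p∣j∸i : p ∣ j ℕ.∸ i
    p∣j∸i = coprime-divisor p⊥m (∣m+n∣m⇒∣n (subst (p ∣_) (begin
      a ℕ.+ j ℕ.* m                               ≡⟨ cong (λ k → a ℕ.+ k ℕ.* m) j≡i+[j∸i] ⟨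
      a ℕ.+ (i ℕ.+ (j ℕ.∸ i)) ℕ.* m
        ≡⟨ solve 4 (λ a i k m → a :+ (i :+ k) :* m := a :+ i :* m :+ m :* k) refl a i (j ℕ.∸ i) m ⟩
      a ℕ.+ i ℕ.* m ℕ.+ m ℕ.* (j ℕ.∸ i)           ∎) p∣j) p∣i)
      where open ℕ.+-*-Solver
    helper : ∀ k → j ℕ.∸ i ≡ k → i ≡ j
    helper zero    j∸i≡0   = trans (sym (ℕ.+-identityʳ i)) (trans (cong (i ℕ.+_) (sym j∸i≡0)) j≡i+[j∸i])
    helper (suc k) j∸i≡1+k = contradiction (∣⇒≤ (subst (p ∣_) j∸i≡1+k p∣j∸i))
      (ℕ.<⇒≱ (subst (ℕ._< p) j∸i≡1+k (ℕ.≤-<-trans (ℕ.m∸n≤m j i) j<p)))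

  ∑-residues : ∀ {p m} .{{_ : NonZero p}} → Coprime p m → ∀ a → ∑ (upTo p) (λ i → 𝟙 (p ∣? a ℕ.+ i ℕ.* m)) ≡ 1ℚ
  ∑-residues {p} {m} p⊥m a = let j , j<p , p∣j = coprime-residue p⊥m a in
    trans (∑-upTo-cong p (λ {i} i<p → 𝟙-⇔ (p ∣? a ℕ.+ i ℕ.* m) (i ℕ.≟ j)
            (λ p∣i → unique i<p j<p p∣i p∣j) (λ { refl → p∣j })))
          (∑-δ p j<p)
    where
    unique : ∀ {i j} → i ℕ.< p → j ℕ.< p → p ∣ a ℕ.+ i ℕ.* m → p ∣ a ℕ.+ j ℕ.* m → i ≡ j
    unique {i} {j} i<p j<p p∣i p∣j with ℕ.≤-total i j
    ... | inj₁ i≤j = coprime-residue-≤ p⊥m a i≤j j<p p∣i p∣j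
    ... | inj₂ j≤i = sym (coprime-residue-≤ p⊥m a j≤i i<p p∣j p∣i)

  c-balanced : ∀ {p} → Prime p → ∀ m .{{_ : NonZero m}} → Acc ℕ._<_ m →
               ∀ a → ∑ (upTo p) (λ i → c (p ℕ.* m) (a ℕ.+ i ℕ.* m)) ≡ 0ℚ
  c-balanced {p} pr m (acc rec) a = helper (p ∣? m) (p ∣? a)
    where
    instance
      p≢0 : NonZero p
      p≢0 = prime⇒nonZero pr

    helper : Dec (p ∣ m) → Dec (p ∣ a) → ∑ (upTo p) (λ i → c (p ℕ.* m) (a ℕ.+ i ℕ.* m)) ≡ 0ℚ
    -- No argument a + i * m is divisible by p, so every term is 0.
    helper (yes p∣m) (no p∤a) = ∑-vanish (upTo p) (λ i → c-ramified-∤ pr m p∣m (λ p∣a+im →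
      p∤a (∣m+n∣m⇒∣n (subst (p ∣_) (ℕ.+-comm a (i ℕ.* m)) p∣a+im) (∣n⇒∣m*n i p∣m))))
    -- All arguments and the modulus are divisible by p; cancelling it once leaves the same sum for
    -- the smaller m / p, which is why the recursion is well-founded on m.
    helper (yes p∣m@(divides m′ m≡m′p)) (yes (divides b a≡bp)) = begin
      ∑ (upTo p) (λ i → c (p ℕ.* m) (a ℕ.+ i ℕ.* m))
        ≡⟨ ∑-cong (upTo p) (λ i → trans (cong (c (p ℕ.* m)) (shift i)) (c-ramified-∣ pr m p∣m (b ℕ.+ i ℕ.* m′))) ⟩
      ∑ (upTo p) (λ i → fromℕ p * c m (b ℕ.+ i ℕ.* m′))
        ≡⟨ *-distribˡ-∑ (fromℕ p) (upTo p) (λ i → c m (b ℕ.+ i ℕ.* m′)) ⟨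
      fromℕ p * ∑ (upTo p) (λ i → c m (b ℕ.+ i ℕ.* m′))
        ≡⟨ cong (λ k → fromℕ p * ∑ (upTo p) (λ i → c k (b ℕ.+ i ℕ.* m′))) (trans m≡m′p (ℕ.*-comm m′ p)) ⟩
      fromℕ p * ∑ (upTo p) (λ i → c (p ℕ.* m′) (b ℕ.+ i ℕ.* m′))
        ≡⟨ cong (fromℕ p *_) (c-balanced pr m′ (rec m′<m) b) ⟩
      fromℕ p * 0ℚ
        ≡⟨ ℚ.*-zeroʳ (fromℕ p) ⟩
      0ℚ ∎
      where
      instance
        m′≢0 : NonZero m′
        m′≢0 = ℕ.≢-nonZero (λ m′≡0 → ℕ.≢-nonZero⁻¹ m (trans m≡m′p (cong (ℕ._* p) m′≡0)))
      m′<m : m′ ℕ.< m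
      m′<m = subst (m′ ℕ.<_) (sym m≡m′p) (ℕ.m<m*n m′ p (ℕ.nonTrivial⇒n>1 p {{prime⇒nonTrivial pr}}))
      shift : ∀ i → a ℕ.+ i ℕ.* m ≡ p ℕ.* (b ℕ.+ i ℕ.* m′)
      shift i = trans (cong₂ (λ x y → x ℕ.+ i ℕ.* y) a≡bp m≡m′p)
        (solve 4 (λ b p i m → b :* p :+ i :* (m :* p) := p :* (b :+ i :* m)) refl b p i m′)
        where open ℕ.+-*-Solver
    -- Since `c m` has period m, it is constant along the progression. Exactly one of the p
    -- arguments is divisible by p, so the other factors add up to p - p.
    helper (no p∤m) _ = begin
      ∑ (upTo p) (λ i → c (p ℕ.* m) (a ℕ.+ i ℕ.* m))
        ≡⟨ ∑-cong (upTo p) (λ i → trans (c-unramified pr m p∤m (a ℕ.+ i ℕ.* m))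
             (cong ((fromℕ p * 𝟙 (p ∣? a ℕ.+ i ℕ.* m) - 1ℚ) *_) (c-cong-gcd m (a ℕ.+ i ℕ.* m) a (gcd-+* m a i)))) ⟩
      ∑ (upTo p) (λ i → (fromℕ p * 𝟙 (p ∣? a ℕ.+ i ℕ.* m) - 1ℚ) * c m a)
        ≡⟨ *-distribʳ-∑ (c m a) (upTo p) (λ i → fromℕ p * 𝟙 (p ∣? a ℕ.+ i ℕ.* m) - 1ℚ) ⟨
      ∑ (upTo p) (λ i → fromℕ p * 𝟙 (p ∣? a ℕ.+ i ℕ.* m) - 1ℚ) * c m a
        ≡⟨ cong (_* c m a) (∑-distrib-+ (upTo p) (λ i → fromℕ p * 𝟙 (p ∣? a ℕ.+ i ℕ.* m)) (λ _ → - 1ℚ)) ⟩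
      (∑ (upTo p) (λ i → fromℕ p * 𝟙 (p ∣? a ℕ.+ i ℕ.* m)) + ∑ (upTo p) (λ _ → - 1ℚ)) * c m a
        ≡⟨ cong (_* c m a) (cong₂ _+_
             (trans (sym (*-distribˡ-∑ (fromℕ p) (upTo p) (λ i → 𝟙 (p ∣? a ℕ.+ i ℕ.* m))))
                    (cong (fromℕ p *_) (∑-residues (prime∤⇒coprime pr p∤m) a)))
             (∑-upTo-const p (- 1ℚ))) ⟩
      (fromℕ p * 1ℚ + fromℕ p * (- 1ℚ)) * c m a
        ≡⟨ solve 2 (λ p x → (p :* con 1ℚ :+ p :* (:- con 1ℚ)) :* x := con 0ℚ) refl (fromℕ p) (c m a) ⟩
      0ℚ ∎
      where open ℚ.+-*-Solver

  c-primitive : ∀ d .{{_ : NonZero d}} → Primitive d (c d)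
  c-primitive d .Primitive.periodic a =
    c-cong-gcd d (a ℕ.+ d) a (trans (cong (λ k → gcd d (a ℕ.+ k)) (sym (ℕ.*-identityˡ d))) (gcd-+* d a 1))
  c-primitive _ .Primitive.balanced p m pr refl a = c-balanced pr m {{ℕ.m*n≢0⇒n≢0 p}} (<-wellFounded m) a

  prime-induction : (P : ℕ → Set) → P 1 → (∀ {p} n .{{_ : NonZero n}} → Prime p → P n → P (p ℕ.* n)) →
                    ∀ n .{{_ : NonZero n}} → P n
  prime-induction P P1 step n = subst P (sym (PrimeFactorisation.isFactorisation f)) (go (PrimeFactorisation.factorsPrime f))
    where
    f = factorise n
    go : ∀ {ps} → All Prime ps → P (product ps)
    go []         = P1
    go (pr ∷ prs) = step _ {{productOfPrimes≢0 prs}} pr (go prs)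

  -- In terms of roots of unity this sums the a-th powers of all n-th roots, sorted by their order.
  -- Here n is instead built up one prime factor at a time.
  ∑-divisors-c : ∀ n .{{_ : NonZero n}} a → ∑ (upTo n) (λ k → 𝟙 (suc k ∣? n) * c (suc k) a) ≡ fromℕ n * 𝟙 (n ∣? a)
  ∑-divisors-c = prime-induction (λ n → ∀ a → D n a ≡ fromℕ n * 𝟙 (n ∣? a)) base step
    where
    D : ℕ → ℕ → ℚ
    D n a = ∑ (upTo n) (λ k → 𝟙 (suc k ∣? n) * c (suc k) a)

    base : ∀ a → D 1 a ≡ fromℕ 1 * 𝟙 (1 ∣? a)
    base a = begin
      1ℚ * c 1 a + 0ℚ
        ≡⟨ cong (λ x → 1ℚ * x + 0ℚ) (c≡hölder 1 {1} a (trans (ℕ.*-identityˡ (gcd 1 a)) (gcd-zeroˡ a))) ⟩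
      1ℚ                   ≡⟨ cong (1ℚ *_) (𝟙-true (1 ∣? a) (1∣ a)) ⟨
      1ℚ * 𝟙 (1 ∣? a)      ∎

    step : ∀ {p} n .{{_ : NonZero n}} → Prime p → (∀ a → D n a ≡ fromℕ n * 𝟙 (n ∣? a)) →
           ∀ a → D (p ℕ.* n) a ≡ fromℕ (p ℕ.* n) * 𝟙 (p ℕ.* n ∣? a)
    step {p} n pr ih a = trans split (helper (p ∣? a))
      where
      instance
        p≢0 : NonZero p
        p≢0 = prime⇒nonZero pr

      T V : ℕ → ℚ
      T s = 𝟙 (s ∣? p ℕ.* n) * c s a
      V s = 𝟙 (s ∣? n) * ((1ℚ - 𝟙 (p ∣? s)) * c s a)

      T-split : ∀ s → T s ≡ 𝟙 (p ∣? s) * T s + V s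
      T-split s = go (p ∣? s)
        where
        open ℚ.+-*-Solver
        go : (p∣?s : Dec (p ∣ s)) → T s ≡ 𝟙 p∣?s * T s + 𝟙 (s ∣? n) * ((1ℚ - 𝟙 p∣?s) * c s a)
        go (yes _)  = solve 3 (λ t i x → t := con 1ℚ :* t :+ i :* ((con 1ℚ :- con 1ℚ) :* x)) refl (T s) (𝟙 (s ∣? n)) (c s a)
        go (no p∤s) = trans
          (cong (_* c s a) (𝟙-⇔ (s ∣? p ℕ.* n) (s ∣? n)
            (coprime-divisor (coprime-sym (prime∤⇒coprime pr p∤s))) (∣n⇒∣m*n p)))
          (solve 3 (λ t i x → i :* x := con 0ℚ :* t :+ i :* ((con 1ℚ :- con 0ℚ) :* x)) refl (T s) (𝟙 (s ∣? n)) (c s a))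

      W : ℕ → ℚ
      W s = c (p ℕ.* s) a + (1ℚ - 𝟙 (p ∣? s)) * c s a

      -- A divisor of p * n is either p * s with s ∣ n, or prime to p and then itself a divisor of
      -- n. `W s` collects both contributions of s.
      split : D (p ℕ.* n) a ≡ ∑ (upTo n) (λ k → 𝟙 (suc k ∣? n) * W (suc k))
      split = begin
        ∑ (upTo (p ℕ.* n)) (λ k → T (suc k))
          ≡⟨ ∑-cong (upTo (p ℕ.* n)) (λ k → T-split (suc k)) ⟩
        ∑ (upTo (p ℕ.* n)) (λ k → 𝟙 (p ∣? suc k) * T (suc k) + V (suc k))
          ≡⟨ ∑-distrib-+ (upTo (p ℕ.* n)) (λ k → 𝟙 (p ∣? suc k) * T (suc k)) (λ k → V (suc k)) ⟩
        ∑ (upTo (p ℕ.* n)) (λ k → 𝟙 (p ∣? suc k) * T (suc k)) + ∑ (upTo (p ℕ.* n)) (λ k → V (suc k))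
          ≡⟨ cong₂ _+_ (∑-multiples p n T) (∑-upTo-extend (ℕ.m≤n*m n p) (λ {k} n≤k →
               𝟙*-false (suc k ∣? n) (λ 1+k∣n → ℕ.<⇒≱ (s≤s n≤k) (∣⇒≤ 1+k∣n)) ((1ℚ - 𝟙 (p ∣? suc k)) * c (suc k) a))) ⟩
        ∑ (upTo n) (λ k → T (p ℕ.* suc k)) + ∑ (upTo n) (λ k → V (suc k))
          ≡⟨ ∑-distrib-+ (upTo n) (λ k → T (p ℕ.* suc k)) (λ k → V (suc k)) ⟨
        ∑ (upTo n) (λ k → T (p ℕ.* suc k) + V (suc k))
          ≡⟨ ∑-cong (upTo n) (λ k → trans
               (cong (λ x → x * c (p ℕ.* suc k) a + V (suc k))
                 (𝟙-⇔ (p ℕ.* suc k ∣? p ℕ.* n) (suc k ∣? n) (*-cancelˡ-∣ p) (*-monoʳ-∣ p)))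
               (sym (ℚ.*-distribˡ-+ (𝟙 (suc k ∣? n)) (c (p ℕ.* suc k) a) ((1ℚ - 𝟙 (p ∣? suc k)) * c (suc k) a)))) ⟩
        ∑ (upTo n) (λ k → 𝟙 (suc k ∣? n) * W (suc k)) ∎

      -- For p ∣ s both parts are 0; for p ∤ s they are opposite.
      W-∤ : p ∤ a → ∀ s .{{_ : NonZero s}} → W s ≡ 0ℚ
      W-∤ p∤a s = go (p ∣? s)
        where
        open ℚ.+-*-Solver
        go : (p∣?s : Dec (p ∣ s)) → c (p ℕ.* s) a + (1ℚ - 𝟙 p∣?s) * c s a ≡ 0ℚ
        go (yes p∣s) = trans (cong (_+ (1ℚ - 1ℚ) * c s a) (c-ramified-∤ pr s p∣s p∤a))
          (solve 1 (λ x → con 0ℚ :+ (con 1ℚ :- con 1ℚ) :* x := con 0ℚ) refl (c s a))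
        go (no p∤s)  = trans (cong (_+ (1ℚ - 0ℚ) * c s a) (c-unramified-∤ pr s p∤s p∤a))
          (solve 1 (λ x → :- x :+ (con 1ℚ :- con 0ℚ) :* x := con 0ℚ) refl (c s a))

      -- For p ∤ s the missing `c s b` in p - 1 copies is supplied by the second part; for p ∣ s the
      -- first part already has all p.
      W-∣ : ∀ {b} → a ≡ p ℕ.* b → ∀ s .{{_ : NonZero s}} → W s ≡ fromℕ p * c s b
      W-∣ {b} a≡pb s = go (p ∣? s)
        where
        open ℚ.+-*-Solver
        go : (p∣?s : Dec (p ∣ s)) → c (p ℕ.* s) a + (1ℚ - 𝟙 p∣?s) * c s a ≡ fromℕ p * c s b
        go (yes p∣s) = trans (cong (_+ (1ℚ - 1ℚ) * c s a) (trans (cong (c (p ℕ.* s)) a≡pb) (c-ramified-∣ pr s p∣s b)))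
          (solve 2 (λ y x → y :+ (con 1ℚ :- con 1ℚ) :* x := y) refl (fromℕ p * c s b) (c s a))
        go (no p∤s)  = trans
          (cong₂ (λ x y → x + (1ℚ - 0ℚ) * y)
            (trans (cong (c (p ℕ.* s)) a≡pb) (c-unramified-∣ pr s p∤s b))
            (trans (cong (c s) a≡pb) (c-coprime pr s p∤s b)))
          (solve 2 (λ p x → (p :- con 1ℚ) :* x :+ (con 1ℚ :- con 0ℚ) :* x := p :* x) refl (fromℕ p) (c s b))

      helper : Dec (p ∣ a) → ∑ (upTo n) (λ k → 𝟙 (suc k ∣? n) * W (suc k)) ≡ fromℕ (p ℕ.* n) * 𝟙 (p ℕ.* n ∣? a)
      helper (no p∤a) = trans
        (∑-vanish (upTo n) (λ k → trans (cong (𝟙 (suc k ∣? n) *_) (W-∤ p∤a (suc k))) (ℚ.*-zeroʳ (𝟙 (suc k ∣? n)))))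
        (sym (trans (cong (fromℕ (p ℕ.* n) *_) (𝟙-false (p ℕ.* n ∣? a) (λ pn∣a → p∤a (m*n∣⇒m∣ p n pn∣a))))
                    (ℚ.*-zeroʳ (fromℕ (p ℕ.* n)))))
      helper (yes (divides b a≡bp)) = begin
        ∑ (upTo n) (λ k → 𝟙 (suc k ∣? n) * W (suc k))
          ≡⟨ ∑-cong (upTo n) (λ k → trans (cong (𝟙 (suc k ∣? n) *_) (W-∣ a≡pb (suc k)))
               (solve 3 (λ i p x → i :* (p :* x) := p :* (i :* x)) refl (𝟙 (suc k ∣? n)) (fromℕ p) (c (suc k) b))) ⟩
        ∑ (upTo n) (λ k → fromℕ p * (𝟙 (suc k ∣? n) * c (suc k) b))
          ≡⟨ *-distribˡ-∑ (fromℕ p) (upTo n) (λ k → 𝟙 (suc k ∣? n) * c (suc k) b) ⟨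
        fromℕ p * D n b
          ≡⟨ cong (fromℕ p *_) (ih b) ⟩
        fromℕ p * (fromℕ n * 𝟙 (n ∣? b))
          ≡⟨ ℚ.*-assoc (fromℕ p) (fromℕ n) (𝟙 (n ∣? b)) ⟨
        fromℕ p * fromℕ n * 𝟙 (n ∣? b)
          ≡⟨ cong₂ _*_ (sym (fromℕ-* p n)) (𝟙-⇔ (n ∣? b) (p ℕ.* n ∣? a)
               (λ n∣b → subst (p ℕ.* n ∣_) (sym a≡pb) (*-monoʳ-∣ p n∣b))
               (λ pn∣a → *-cancelˡ-∣ p (subst (p ℕ.* n ∣_) a≡pb pn∣a))) ⟩
        fromℕ (p ℕ.* n) * 𝟙 (p ℕ.* n ∣? a) ∎
        where
        open ℚ.+-*-Solver
        a≡pb : a ≡ p ℕ.* b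
        a≡pb = trans a≡bp (ℕ.*-comm b p)

  -- Counting words by the residue of inv

  module _ (v h : ℕ) .{{_ : NonZero (v ℕ.+ h)}} (a : ℤ) where

    open import Data.Integer using (∣_∣)

    private
      n = v ℕ.+ h
      g = gcd n v

      -- Shifts act on functions of a natural number, so the integer -a is replaced by its natural
      -- representative modulo n, and inv x - a by `inv x + -a%n`.
      -a%n : ℕ
      -a%n = (ℤ.- a) ℤ.%ℕ n

      i-a : ∀ i → ℤ.+ i ℤ.- a ≡ ℤ.+ (i ℕ.+ -a%n) ℤ.+ (ℤ.- a) ℤ./ℕ n ℤ.* ℤ.+ n
      i-a i = trans (cong (ℤ._+_ (ℤ.+ i)) (ℤ.a≡a%ℕn+[a/ℕn]*n (ℤ.- a) n))
        (sym (ℤ.+-assoc (ℤ.+ i) (ℤ.+ -a%n) ((ℤ.- a) ℤ./ℕ n ℤ.* ℤ.+ n)))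

      ∣i+-a%n⇒∣i-a : ∀ {k} → k ∣ n → ∀ i → k ∣ i ℕ.+ -a%n → k ∣ ∣ ℤ.+ i ℤ.- a ∣
      ∣i+-a%n⇒∣i-a {k} k∣n i k∣ = ℤ.∣⇒∣ᵤ {ℤ.+ k} (subst (ℤ._∣_ (ℤ.+ k)) (sym (i-a i))
        (ℤ.∣m∣n⇒∣m+n (ℤ.∣ᵤ⇒∣ {ℤ.+ k} {ℤ.+ (i ℕ.+ -a%n)} k∣)
                     (ℤ.∣n⇒∣m*n ((ℤ.- a) ℤ./ℕ n) (ℤ.∣ᵤ⇒∣ {ℤ.+ k} {ℤ.+ n} k∣n))))

      ∣i-a⇒∣i+-a%n : ∀ {k} → k ∣ n → ∀ i → k ∣ ∣ ℤ.+ i ℤ.- a ∣ → k ∣ i ℕ.+ -a%n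
      ∣i-a⇒∣i+-a%n {k} k∣n i k∣ = ℤ.∣⇒∣ᵤ {ℤ.+ k} {ℤ.+ (i ℕ.+ -a%n)}
        (ℤ.∣m+n∣n⇒∣m (subst (ℤ._∣_ (ℤ.+ k)) (i-a i) (ℤ.∣ᵤ⇒∣ {ℤ.+ k} k∣))
                     (ℤ.∣n⇒∣m*n ((ℤ.- a) ℤ./ℕ n) (ℤ.∣ᵤ⇒∣ {ℤ.+ k} {ℤ.+ n} k∣n)))

      ∣0-a∣≡∣a∣ : ∣ ℤ.+ 0 ℤ.- a ∣ ≡ ∣ a ∣
      ∣0-a∣≡∣a∣ = trans (cong ∣_∣ (ℤ.+-identityˡ (ℤ.- a))) (ℤ.∣-i∣≡∣i∣ a)

      -- Divisors of n cannot tell -a from its residue modulo n, nor a from -a; this is the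
      -- divisibility transfer at i = 0.
      gcd-residue : ∀ {d} → d ∣ n → gcd d ∣ a ∣ ≡ gcd d -a%n
      gcd-residue {d} d∣n = ∣-antisym
        (gcd-greatest (gcd[m,n]∣m d _) (∣i-a⇒∣i+-a%n (∣-trans (gcd[m,n]∣m d _) d∣n) 0
          (subst (gcd d ∣ a ∣ ∣_) (sym ∣0-a∣≡∣a∣) (gcd[m,n]∣n d _))))
        (gcd-greatest (gcd[m,n]∣m d _) (subst (gcd d -a%n ∣_) ∣0-a∣≡∣a∣
          (∣i+-a%n⇒∣i-a (∣-trans (gcd[m,n]∣m d _) d∣n) 0 (gcd[m,n]∣n d _))))

      𝟙-Y : ∀ x → 𝟙 (Y? v h a x) ≡ 𝟙 (zeros x ℕ.≟ v) * 𝟙 (n ∣? inv x ℕ.+ -a%n)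
      𝟙-Y x = trans
        (𝟙-⇔ (Y? v h a x) (zeros x ℕ.≟ v ×-dec n ∣? inv x ℕ.+ -a%n)
          (λ (z≡v , _ , n∣) → z≡v , ∣i-a⇒∣i+-a%n ∣-refl (inv x) n∣)
          (λ (z≡v , n∣) → z≡v
            , ℕ.+-cancelˡ-≡ v (ones x) h (trans (cong (ℕ._+ ones x) (sym z≡v)) (zeros+ones x))
            , ∣i+-a%n⇒∣i-a ∣-refl (inv x) n∣))
        (𝟙-× (zeros x ℕ.≟ v) (n ∣? inv x ℕ.+ -a%n))

      -- `∑-divisors-c` at `inv x + -a%n` turns the congruence condition into Ramanujan sums;
      -- exchanging the two sums then produces the Gaussian binomials.
      n*#Y : fromℕ n * fromℕ (# Y? v h a) ≡ ∑ (upTo n) (λ k → 𝟙 (suc k ∣? n) * gauss n v (c (suc k)) -a%n)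
      n*#Y = begin
        fromℕ n * fromℕ (# Y? v h a)
          ≡⟨ cong (fromℕ n *_) (trans (fromℕ-length-filter (Y? v h a) (words n)) (∑-cong (words n) 𝟙-Y)) ⟩
        fromℕ n * ∑ (words n) (λ x → z x * 𝟙 (n ∣? inv x ℕ.+ -a%n))
          ≡⟨ *-distribˡ-∑ (fromℕ n) (words n) (λ x → z x * 𝟙 (n ∣? inv x ℕ.+ -a%n)) ⟩
        ∑ (words n) (λ x → fromℕ n * (z x * 𝟙 (n ∣? inv x ℕ.+ -a%n)))
          ≡⟨ ∑-cong (words n) (λ x → begin
               fromℕ n * (z x * 𝟙 (n ∣? inv x ℕ.+ -a%n))
                 ≡⟨ swap (fromℕ n) (z x) (𝟙 (n ∣? inv x ℕ.+ -a%n)) ⟩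
               z x * (fromℕ n * 𝟙 (n ∣? inv x ℕ.+ -a%n))
                 ≡⟨ cong (z x *_) (∑-divisors-c n (inv x ℕ.+ -a%n)) ⟨
               z x * ∑ (upTo n) (λ k → 𝟙 (suc k ∣? n) * c (suc k) (inv x ℕ.+ -a%n))
                 ≡⟨ *-distribˡ-∑ (z x) (upTo n) (λ k → 𝟙 (suc k ∣? n) * c (suc k) (inv x ℕ.+ -a%n)) ⟩
               ∑ (upTo n) (λ k → z x * (𝟙 (suc k ∣? n) * c (suc k) (inv x ℕ.+ -a%n))) ∎) ⟩
        ∑ (words n) (λ x → ∑ (upTo n) (λ k → z x * (𝟙 (suc k ∣? n) * c (suc k) (inv x ℕ.+ -a%n))))
          ≡⟨ ∑-comm (words n) (upTo n) (λ x k → z x * (𝟙 (suc k ∣? n) * c (suc k) (inv x ℕ.+ -a%n))) ⟩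
        ∑ (upTo n) (λ k → ∑ (words n) (λ x → z x * (𝟙 (suc k ∣? n) * c (suc k) (inv x ℕ.+ -a%n))))
          ≡⟨ ∑-cong (upTo n) (λ k → trans
               (∑-cong (words n) (λ x → swap (z x) (𝟙 (suc k ∣? n)) (c (suc k) (inv x ℕ.+ -a%n))))
               (sym (*-distribˡ-∑ (𝟙 (suc k ∣? n)) (words n) (λ x → z x * c (suc k) (inv x ℕ.+ -a%n))))) ⟩
        ∑ (upTo n) (λ k → 𝟙 (suc k ∣? n) * gauss n v (c (suc k)) -a%n) ∎
        where
        z : Word n → ℚ
        z x = 𝟙 (zeros x ℕ.≟ v)
        swap : ∀ p q r → p * (q * r) ≡ q * (p * r)
        swap = solve 3 (λ p q r → p :* (q :* r) := q :* (p :* r)) refl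
          where open ℚ.+-*-Solver

      summand≡ : ∀ k → suc k ∣ n → summand v h a (suc k) ≡ c (suc k) -a%n * fromℕ ((n ℕ./ suc k) C (v ℕ./ suc k))
      summand≡ k d∣n = cong (_* fromℕ ((n ℕ./ suc k) C (v ℕ./ suc k)))
        (hölder-cong (suc k) {{d/⟨d,a⟩-nonZero (suc k) a}} {{d/⟨d,a⟩-nonZero (suc k) (ℤ.+ -a%n)}}
          (ℕ./-congʳ {{gcd-nonZero (suc k) a}} {{gcd-nonZero (suc k) (ℤ.+ -a%n)}} (gcd-residue d∣n)))

      gauss-∤ : ∀ d .{{_ : NonZero d}} → d ∣ n → d ∤ v → gauss n v (c d) -a%n ≡ 0ℚ
      gauss-∤ d d∣n d∤v = trans (cong (λ m → gauss m v (c d) -a%n) (sym (ℕ.m/n*n≡m d∣n)))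
        (q-lucas-∤ (c-primitive d) (n ℕ./ d) v -a%n d∤v)

      gauss-∣ : ∀ d .{{_ : NonZero d}} → d ∣ n → d ∣ v →
                gauss n v (c d) -a%n ≡ c d -a%n * fromℕ ((n ℕ./ d) C (v ℕ./ d))
      gauss-∣ d d∣n d∣v = begin
        gauss n v (c d) -a%n
          ≡⟨ cong₂ (λ m w → gauss m w (c d) -a%n) (ℕ.m/n*n≡m d∣n) (ℕ.m/n*n≡m d∣v) ⟨
        gauss (n ℕ./ d ℕ.* d) (v ℕ./ d ℕ.* d) (c d) -a%n
          ≡⟨ q-lucas (c-primitive d) (n ℕ./ d) (v ℕ./ d) -a%n ⟩
        fromℕ ((n ℕ./ d) C (v ℕ./ d)) * c d -a%n
          ≡⟨ ℚ.*-comm (fromℕ ((n ℕ./ d) C (v ℕ./ d))) (c d -a%n) ⟩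
        c d -a%n * fromℕ ((n ℕ./ d) C (v ℕ./ d)) ∎

      gauss-c : ∀ k → suc k ∣ n → gauss n v (c (suc k)) -a%n ≡ 𝟙 (suc k ∣? v) * summand v h a (suc k)
      gauss-c k d∣n = helper (suc k ∣? v)
        where
        helper : (d∣?v : Dec (suc k ∣ v)) → gauss n v (c (suc k)) -a%n ≡ 𝟙 d∣?v * summand v h a (suc k)
        helper (no d∤v)  = trans (gauss-∤ (suc k) d∣n d∤v) (sym (ℚ.*-zeroˡ (summand v h a (suc k))))
        helper (yes d∣v) = trans (gauss-∣ (suc k) d∣n d∣v)
          (trans (sym (summand≡ k d∣n)) (sym (ℚ.*-identityˡ (summand v h a (suc k)))))

      ∑-summands : ∑ (upTo n) (λ k → 𝟙 (suc k ∣? n) * gauss n v (c (suc k)) -a%n)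
                   ≡ divisorSum g (λ d → summand v h a d)
      ∑-summands = begin
        ∑ (upTo n) (λ k → 𝟙 (suc k ∣? n) * gauss n v (c (suc k)) -a%n)
          ≡⟨ ∑-cong (upTo n) (λ k → 𝟙*-cong (suc k ∣? n) (gauss-c k)) ⟩
        ∑ (upTo n) (λ k → 𝟙 (suc k ∣? n) * (𝟙 (suc k ∣? v) * summand v h a (suc k)))
          ≡⟨ ∑-cong (upTo n) (λ k → trans
               (sym (ℚ.*-assoc (𝟙 (suc k ∣? n)) (𝟙 (suc k ∣? v)) (summand v h a (suc k))))
               (cong (_* summand v h a (suc k)) (trans (sym (𝟙-× (suc k ∣? n) (suc k ∣? v)))
                 (𝟙-⇔ (suc k ∣? n ×-dec suc k ∣? v) (suc k ∣? g)
                   (λ (d∣n , d∣v) → gcd-greatest d∣n d∣v)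
                   (λ d∣g → ∣-trans d∣g (gcd[m,n]∣m n v) , ∣-trans d∣g (gcd[m,n]∣n n v)))))) ⟩
        ∑ (upTo n) (λ k → 𝟙 (suc k ∣? g) * summand v h a (suc k))
          -- The common divisors of n and v divide g, so the range shrinks from n to g.
          ≡⟨ ∑-upTo-extend (∣⇒≤ (gcd[m,n]∣m n v)) (λ {k} g≤k →
               𝟙*-false (suc k ∣? g) (λ d∣g → ℕ.<⇒≱ (s≤s g≤k) (∣⇒≤ {{g≢0}} d∣g)) (summand v h a (suc k))) ⟩
        ∑ (upTo g) (λ k → 𝟙 (suc k ∣? g) * summand v h a (suc k))
          ≡⟨ ∑-filter (λ k → suc k ∣? g) (upTo g) (λ k → summand v h a (suc k)) ⟨
        divisorSum g (λ d → summand v h a d) ∎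
        where
        g≢0 : NonZero g
        g≢0 = ℕ.≢-nonZero (gcd[m,n]≢0 n v (inj₁ (ℕ.≢-nonZero⁻¹ n)))

    #Y-formula : fromℕ (# Y? v h a) ≡ (1ℤ ℚ./ n) * divisorSum g (λ d → summand v h a d)
    #Y-formula = n*x≡y⇒x≡1/n*y n (trans n*#Y ∑-summands)

open import Data.Nat using (ℕ; NonZero; _+_)
open import Data.Nat.GCD using (gcd)
open import Data.Integer using (ℤ; +_)
open import Data.Rational using (_/_; _*_)
open import Data.Product using (_×_; _,_)
open import Relation.Binary.PropositionalEquality using (_≡_)

theorem10p2 : (v h : ℕ) .{{_ : NonZero v}} .{{_ : NonZero h}} (a : ℤ) →
    let instance _ = +-nonZero v h in
    # B? v h a ≡ # Y? v h a
    × + (# Y? v h a) / 1 ≡ (+ 1 / (v + h)) * (Σ[ d ∣ gcd (v + h) v ] summand v h a d)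
theorem10p2 v h a = #B≡#Y v h a , #Y-formula v h {{+-nonZero v h}} a
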